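{- Let $t:\mathbb N\to\mathbb N$ be non-polynomial and time-constructible. Then the set $L_t$ (defined in the context) has a recursive jump operator.
   Context: $\Sigma=\{0,1\}$, $\mathbb N^+$ denotes the positive integers, and $P_1,P_2,\dots$ is a standard enumeration of (deterministic) Turing transducers; $a$ is called the code of $P_a$. A function $t:\mathbb N\to\mathbb N$ is non-polynomial if for every polynomial $p$ there is an $n\in\mathbb N$ with $t(n)\ge p(n)$. It is time-constructible if $t(n)\ge n$ for all $n$ and the function $x\mapsto t(|x|)$ (output in binary) is computable by a deterministic Turing machine in time $O(t(|x|))$. Definition of $L_t$: A non-deterministic Turing acceptor $N$ is a non-deterministic Turing machine which may run forever on some paths; $\mathrm{time}(N(x))$ denotes the number of steps of the shortest accepting path of $N$ on input $x$. Let $N_1,N_2,\dots$ be a standard enumeration of non-deterministic Turing acceptors, and let $U$ be a universal non-deterministic acceptor that on input $0^i1x$ simulates $N_i(0^i1x)$, such that for each $i$ there is a constant $c_i$ with $\mathrm{time}(U(0^i1x))\le c_i\,\mathrm{time}(N_i(0^i1x))+c_i$. For $i\in\mathbb N^+$ let $$L_{i,t}=\{x\in 0^i10^* \mid U(x)\text{ does not accept in less than }t(|x|)\text{ steps}\},\qquad L_t=\bigcup_{i\in\mathbb N^+}L_{i,t},$$ where $0^i10^*=\{0^i10^j\mid j\in\mathbb N\}$. A proof system for a set $L\subseteq\Sigma^*$ is a Turing transducer that runs in polynomial time and computes a (total) function $f$ with range $\mathrm{ran}(f)=L$. (Only transducers that themselves run in polynomial time count as proof systems.) A proof system $f$ simulates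 a proof system $g$ if there are a total function $\pi:\Sigma^*\to\Sigma^*$ and a polynomial $p$ with $|\pi(x)|\le p(|x|)$ and $f(\pi(x))=g(x)$ for all $x\in\Sigma^*$. A jump operator for $L$ is a function $J:\mathbb N^+\to\mathbb N^+$ such that whenever $P_a$ is a proof system for $L$, $P_{J(a)}$ is a proof system for $L$ that is not simulated by $P_a$. A recursive jump operator is a jump operator that is a (total) recursive function. -}

module Defs where

open import Data.Digit using (Bit; 0b; 1b; toDigits)
open import Data.Fin using (Fin)
import Data.Fin.Properties as Fin
open import Data.List using (List; []; _∷_; _++_; [_]; foldr; length; map; replicate; reverse)
open import Data.List.Membership.Propositional using (_∈_)
open import Data.List.Relation.Unary.AllPairs using (AllPairs; []; allPairs?)
open import Data.Maybe using (Maybe; just; nothing; fromMaybe)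
import Data.Maybe.Relation.Unary.All as Maybe
open import Data.Nat using (ℕ; zero; suc; _+_; _*_; _≤_; _<_; _≥_; NonZero)
import Data.Nat.Properties as ℕ
open import Data.Product using (Σ; Σ-syntax; ∃; ∃-syntax; _×_; _,_; proj₁; proj₂)
open import Data.Unit using (tt)
open import Data.Vec as Vec using (Vec; []; _∷_)
open import Data.Vec.Relation.Binary.Pointwise.Inductive as Pointwise using (Pointwise)
open import Function using (_⇔_)
open import Level using (0ℓ)
open import Relation.Binary using (Decidable)
open import Relation.Binary.PropositionalEquality using (_≡_; refl; cong)
open import Relation.Nullary using (¬_; Dec; yes; no)
open import Relation.Nullary.Decidable using (map′; _×-dec_; ¬?)
open import Relation.Unary using (Pred; _≐_; ⋃)

Word : Set
Word = List Bit

Language : Set₁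
Language = Pred Word 0ℓ

ℕ⁺ : Set
ℕ⁺ = ∃ NonZero

value : ℕ⁺ → ℕ
value = proj₁

-- `toDigits` puts the least significant digit first.
binary : ℕ → Word
binary n = reverse (proj₁ (toDigits 2 n))

-- Coefficients in ℕ, constant term first.  Polynomials serve only as
-- upper bounds, and these dominate those with integer or real coefficients.
Polynomial : Set
Polynomial = List ℕ

eval : Polynomial → ℕ → ℕ
eval p n = foldr (λ a r → a + n * r) 0 p

-- States and tape symbols are drawn from infinite supplies, but a
-- program is a finite list of instructions and so mentions only
-- finitely many of them.

data Sym : Set where
  blank : Sym
  bit   : Bit → Sym
  aux   : ℕ → Sym

data Move : Set where
  stay left right : Move

-- The start state is run 0; halt is the halting state of transducers and
-- the accepting state of acceptors.
data State : Set where
  halt : State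
  run  : ℕ → State

-- `reads = nothing` matches every symbol and `writes = nothing` leaves
-- the scanned symbol unchanged: such an instruction abbreviates the
-- finitely many ordinary ones obtained by ranging over the alphabet.
record Action : Set where
  constructor action
  field
    reads  : Maybe Sym
    writes : Maybe Sym
    move   : Move

record Instruction (k : ℕ) : Set where
  constructor instruction
  field
    from    : ℕ
    to      : State
    actions : Vec Action k

Program : ℕ → Set
Program k = List (Instruction k)

-- There is always at least one tape, the one carrying the input.
record Machine : Set where
  constructor machine
  field
    extraTapes : ℕ
    program    : Program (suc extraTapes)

  tapeCount : ℕ
  tapeCount = suc extraTapes

-- A two-way infinite tape, all but finitely much of it blank.  The part
-- before the head is listed starting next to the head.
record Tape : Set where
  constructor tape
  field
    before  : List Sym
    scanned : Sym
    after   : List Sym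

shift : Move → Tape → Tape
shift stay  t                   = t
shift left  (tape []       s r) = tape [] blank (s ∷ r)
shift left  (tape (x ∷ l)  s r) = tape l x (s ∷ r)
shift right (tape l s [])       = tape (s ∷ l) blank []
shift right (tape l s (x ∷ r))  = tape (s ∷ l) x r

act : Action → Tape → Tape
act (action _ w m) (tape l s r) = shift m (tape l (fromMaybe s w) r)

-- On the empty input the head scans a blank.
inputTape : Word → Tape
inputTape []      = tape [] blank []
inputTape (b ∷ w) = tape [] (bit b) (map bit w)

emptyTape : Tape
emptyTape = inputTape []

record Config (k : ℕ) : Set where
  constructor config
  field
    state : State
    tapes : Vec Tape k

initial : (M : Machine) → Word → Config (Machine.tapeCount M)
initial M w = config (run 0) (inputTape w ∷ Vec.replicate _ emptyTape)

Matches : Action → Tape → Set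
Matches a t = Maybe.All (_≡ Tape.scanned t) (Action.reads a)

-- No instruction is applicable in state halt.
data Step (M : Machine) : (c d : Config (Machine.tapeCount M)) → Set where
  step : ∀ {q r as ts} →
         instruction q r as ∈ Machine.program M →
         Pointwise Matches as ts →
         Step M (config (run q) ts) (config r (Vec.zipWith act as ts))

data Steps (M : Machine) : ℕ → (c d : Config (Machine.tapeCount M)) → Set where
  done : ∀ {c} → Steps M 0 c c
  _◅_  : ∀ {n c d e} → Step M c d → Steps M n d e → Steps M (suc n) c e

-- Two instructions overlap if some configuration makes both applicable.
data Compatible : Maybe Sym → Maybe Sym → Set where
  anyˡ : ∀ {y} → Compatible nothing y
  anyʳ : ∀ {x} → Compatible x nothing
  same : ∀ {s} → Compatible (just s) (just s)

Overlap : ∀ {k} → Instruction k → Instruction k → Set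
Overlap i j =
  Instruction.from i ≡ Instruction.from j ×
  Pointwise (λ a b → Compatible (Action.reads a) (Action.reads b))
            (Instruction.actions i) (Instruction.actions j)

Deterministic : Machine → Set
Deterministic M = AllPairs (λ i j → ¬ Overlap i j) (Machine.program M)

_≟ˢ_ : Decidable {A = Sym} _≡_
blank ≟ˢ blank = yes refl
blank ≟ˢ bit _ = no λ ()
blank ≟ˢ aux _ = no λ ()
bit _ ≟ˢ blank = no λ ()
bit a ≟ˢ bit b = map′ (cong bit) (λ { refl → refl }) (a Fin.≟ b)
bit _ ≟ˢ aux _ = no λ ()
aux _ ≟ˢ blank = no λ ()
aux _ ≟ˢ bit _ = no λ ()
aux m ≟ˢ aux n = map′ (cong aux) (λ { refl → refl }) (m ℕ.≟ n)

compatible? : Decidable Compatible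
compatible? nothing  _        = yes anyˡ
compatible? (just _) nothing  = yes anyʳ
compatible? (just s) (just u) =
  map′ (λ { refl → same }) (λ { same → refl }) (s ≟ˢ u)

overlap? : ∀ {k} → Decidable (Overlap {k})
overlap? i j =
  (Instruction.from i ℕ.≟ Instruction.from j) ×-dec
  Pointwise.decidable (λ a b → compatible? (Action.reads a) (Action.reads b))
    (Instruction.actions i) (Instruction.actions j)

deterministic? : (M : Machine) → Dec (Deterministic M)
deterministic? M = allPairs? (λ i j → ¬? (overlap? i j)) (Machine.program M)

record Transducer : Set where
  constructor transducer
  field
    code          : Machine
    deterministic : Deterministic code

-- The output stands on the first tape, from the head up to the first
-- blank; the blank appended here is the one beyond the stored part.
Reads : Tape → Word → Set
Reads (tape _ s r) y = ∃[ z ] (s ∷ r) ++ [ blank ] ≡ map bit y ++ blank ∷ z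

Outputs : Transducer → Word → ℕ → Word → Set
Outputs T x n y = ∃[ t ] ∃[ ts ]
  Steps M n (initial M x) (config halt (t ∷ ts)) × Reads t y
  where M = Transducer.code T

Acceptor : Set
Acceptor = Machine

0^_1·_ : ℕ → Word → Word
0^ i 1· x = replicate i 0b ++ 1b ∷ x

AcceptsIn : Acceptor → Word → ℕ → Set
AcceptsIn N x n = ∃[ ts ] Steps N n (initial N x) (config halt ts)

Accepts : Acceptor → Word → Set
Accepts N x = ∃[ n ] AcceptsIn N x n

Time : Acceptor → Word → ℕ → Set
Time N x n = AcceptsIn N x n × (∀ m → m < n → ¬ AcceptsIn N x m)

-- The inverse of Cantor's pairing function, walking along the diagonals
-- (0,0), (1,0), (0,1), (2,0), (1,1), (0,2), …
unpair : ℕ → ℕ × ℕ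
unpair zero = 0 , 0
unpair (suc n) with unpair n
... | zero  , y = suc y , 0
... | suc x , y = x , suc y

decodeVec : ∀ {A : Set} → (ℕ → A) → ∀ k → ℕ → Vec A k
decodeVec f zero    n = []
decodeVec f (suc k) n = f (proj₁ (unpair n)) ∷ decodeVec f k (proj₂ (unpair n))

decodeList : ∀ {A : Set} → (ℕ → A) → ℕ → List A
decodeList f n = Vec.toList (decodeVec f (proj₁ (unpair n)) (proj₂ (unpair n)))

decodeSym : ℕ → Sym
decodeSym 0                   = blank
decodeSym 1                   = bit 0b
decodeSym 2                   = bit 1b
decodeSym (suc (suc (suc n))) = aux n

decodeMaybeSym : ℕ → Maybe Sym
decodeMaybeSym zero    = nothing
decodeMaybeSym (suc n) = just (decodeSym n)

decodeMove : ℕ → Move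
decodeMove 0             = stay
decodeMove 1             = left
decodeMove (suc (suc _)) = right

decodeState : ℕ → State
decodeState zero    = halt
decodeState (suc q) = run q

decodeAction : ℕ → Action
decodeAction n =
  let r , n′ = unpair n
      w , m  = unpair n′
  in action (decodeMaybeSym r) (decodeMaybeSym w) (decodeMove m)

decodeInstruction : ∀ k → ℕ → Instruction k
decodeInstruction k n =
  let q , n′ = unpair n
      r , as = unpair n′
  in instruction q (decodeState r) (decodeVec decodeAction k as)

decodeMachine : ℕ → Machine
decodeMachine n =
  let k , p = unpair n
  in machine k (decodeList (decodeInstruction (suc k)) p)

𝐍 : ℕ⁺ → Acceptor
𝐍 (suc a , _) = decodeMachine a

-- Codes of machines that are not deterministic are assigned the
-- transducer without instructions.
𝐏 : ℕ⁺ → Transducer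
𝐏 (suc a , _) with deterministic? (decodeMachine a)
... | yes d = transducer (decodeMachine a) d
... | no  _ = transducer (machine 0 []) []

record Universal (U : Acceptor) : Set where
  field
    simulates : ∀ (i : ℕ⁺) x →
      Accepts U (0^ value i 1· x) ⇔ Accepts (𝐍 i) (0^ value i 1· x)
    overhead  : ∀ (i : ℕ⁺) → ∃[ c ] ∀ x n →
      Time (𝐍 i) (0^ value i 1· x) n →
      ∃[ m ] Time U (0^ value i 1· x) m × m ≤ c * n + c

Lᵢ : Acceptor → (ℕ → ℕ) → ℕ⁺ → Language
Lᵢ U t i x =
  (∃[ j ] x ≡ 0^ value i 1· replicate j 0b) ×
  ¬ (∃[ n ] n < t (length x) × AcceptsIn U x n)

L : Acceptor → (ℕ → ℕ) → Language
L U t = ⋃[ i ∶ ℕ⁺ ] Lᵢ U t i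

NonPolynomial : (ℕ → ℕ) → Set
NonPolynomial t = ∀ (p : Polynomial) → ∃[ n ] t n ≥ eval p n

record TimeConstructible (t : ℕ → ℕ) : Set where
  field
    n≤t[n]   : ∀ n → n ≤ t n
    computer : Transducer
    c n₀     : ℕ
    computes : ∀ x → ∃[ s ]
      Outputs computer x s (binary (t (length x))) ×
      (n₀ ≤ length x → s ≤ c * t (length x))

record ProofSystem (T : Transducer) (A : Language) : Set where
  field
    function : Word → Word
    bound    : Polynomial
    computes : ∀ x → ∃[ s ] s ≤ eval bound (length x) × Outputs T x s (function x)
    range    : (λ y → ∃[ x ] function x ≡ y) ≐ A

Simulates : (f g : Word → Word) → Set
Simulates f g = Σ[ π ∈ (Word → Word) ] Σ[ p ∈ Polynomial ]
  (∀ x → length (π x) ≤ eval p (length x) × f (π x) ≡ g x)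

JumpOperator : Language → (ℕ⁺ → ℕ⁺) → Set
JumpOperator A J = ∀ a → (f : ProofSystem (𝐏 a) A) →
  Σ[ g ∈ ProofSystem (𝐏 (J a)) A ]
    ¬ Simulates (ProofSystem.function f) (ProofSystem.function g)

data Rec : ℕ → Set where
  zero : Rec 0
  suc  : Rec 1
  proj : ∀ {n} → Fin n → Rec n
  comp : ∀ {m n} → Rec m → Vec (Rec n) m → Rec n
  prec : ∀ {n} → Rec n → Rec (suc (suc n)) → Rec (suc n)
  μ    : ∀ {n} → Rec (suc n) → Rec n

data _[_]⇓_ : ∀ {n} → Rec n → Vec ℕ n → ℕ → Set where
  zero   : zero [ [] ]⇓ 0
  suc    : ∀ {x} → suc [ x ∷ [] ]⇓ suc x
  proj   : ∀ {n} {i : Fin n} {xs} → proj i [ xs ]⇓ Vec.lookup xs i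
  comp   : ∀ {m n} {f : Rec m} {gs : Vec (Rec n) m} {xs ys z} →
           Pointwise (λ g y → g [ xs ]⇓ y) gs ys → f [ ys ]⇓ z →
           comp f gs [ xs ]⇓ z
  prec-0 : ∀ {n} {f : Rec n} {g xs z} →
           f [ xs ]⇓ z → prec f g [ 0 ∷ xs ]⇓ z
  prec-s : ∀ {n} {f : Rec n} {g x xs y z} →
           prec f g [ x ∷ xs ]⇓ y → g [ x ∷ y ∷ xs ]⇓ z →
           prec f g [ suc x ∷ xs ]⇓ z
  μ      : ∀ {n} {f : Rec (suc n)} {xs y} →
           f [ y ∷ xs ]⇓ 0 →
           (∀ x → x < y → ∃[ z ] f [ x ∷ xs ]⇓ suc z) →
           μ f [ xs ]⇓ y

Recursive : (ℕ⁺ → ℕ⁺) → Set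
Recursive J = ∃[ f ] ∀ a → f [ value a ∷ [] ]⇓ value (J a)

HasRecursiveJumpOperator : Language → Set
HasRecursiveJumpOperator A = Σ[ J ∈ (ℕ⁺ → ℕ⁺) ] JumpOperator A J × Recursive J

{-# OPTIONS --safe #-}

-- Let P_a be a proof system for L_t with function F.  The acceptor N_i that on
-- input x guesses y, runs P_a on y and compares the output with x accepts
-- exactly L_t.  So if x = 0^i 1 0^j were accepted by U in less than t(|x|)
-- steps, N_i would accept x and x would lie in L_t, against the definition of
-- L_t.  Hence every 0^i 1 0^j lies in L_t, and N_i accepts it only after about
-- t(|x|) steps: the proofs of these words in P_a are not polynomially bounded,
-- as t is not.  Adding to P_a short proofs of them gives the proof system
-- P_{J(a)}: it maps 1z to F(z) and every other w to 0^i 1 0^|w|.  Since i and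
-- then J(a) are codes of explicit modifications of the program of P_a, they
-- are primitive recursive in a.

module Submission where

open import Defs
open import Data.Digit using (0b; 1b)
open import Data.Fin using (Fin; zero; suc)
open import Data.Fin.Patterns using (0F; 1F; 2F)
open import Data.List using (List; []; _∷_; _++_; [_]; map; reverse; length; replicate; applyUpTo; applyDownFrom)
open import Data.List.Membership.Propositional using (_∈_)
open import Data.List.Membership.Propositional.Properties using (∈-map⁺; ∈-map⁻; ∈-++⁺ˡ; ∈-++⁺ʳ; ∈-++⁻; ∈-applyDownFrom⁺)
open import Data.List.Properties using (++-assoc; ∷-injective; length-++; length-replicate; map-++; map-applyUpTo; map-replicate; reverse-applyUpTo)
open import Data.List.Relation.Binary.Permutation.Propositional using (↭-sym; ↭⇒↭ₛ)
open import Data.List.Relation.Binary.Permutation.Propositional.Properties using (↭-reverse)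
open import Data.List.Relation.Binary.Permutation.Setoid.Properties using (AllPairs-resp-↭)
open import Data.List.Relation.Unary.All as All using (All; []; _∷_)
import Data.List.Relation.Unary.All.Properties as All
open import Data.List.Relation.Unary.AllPairs as AllPairs using (AllPairs; []; _∷_; allPairs?)
import Data.List.Relation.Unary.AllPairs.Properties as AllPairs
open import Data.List.Relation.Unary.Any using (here; there)
open import Data.List.Relation.Unary.Any.Properties using (reverse⁺; reverse⁻)
open import Data.Maybe using (Maybe; just; nothing)
import Data.Maybe.Relation.Unary.All as Maybe
open import Data.Nat
open import Data.Nat.Induction using (<-rec)
open import Data.Nat.Properties
open import Data.Nat.Solver using (module +-*-Solver)
open import Data.Product using (Σ-syntax; ∃-syntax; _×_; _,_; proj₁; proj₂)
open import Data.Sum using (_⊎_; inj₁; inj₂)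
open import Data.Unit using (tt)
open import Data.Vec as Vec using (Vec; []; _∷_; lookup)
open import Data.Vec.Relation.Binary.Pointwise.Inductive as Pointwise using (Pointwise; []; _∷_)
open import Function using (_∘_; id; Equivalence)
open import Relation.Binary.PropositionalEquality using (_≡_; refl; sym; trans; cong; cong₂; subst; setoid; resp₂; module ≡-Reasoning)
open import Relation.Nullary using (¬_; contradiction; yes; no)
open import Relation.Nullary.Decidable using (toWitness; ¬?)
open import Relation.Unary using (_≐_)

-- Pairing and primitive recursion

-- The constructions have to be uniform in `a`: the tapes and instructions of the given machine are
-- known only through its code. Its program is therefore modified by primitive recursion on codes,
-- entry by entry, which leaves the instructions in reversed order; neither applicability nor
-- pairwise non-overlap depends on that order. Non-polynomiality supplies only one length at which
-- `t` reaches a given polynomial, and no word `0^i 1 0^j` has length at most `i`. A bound of `t` on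
-- these lengths, added to the polynomial, forces the length beyond `i`. The overhead of `U` is
-- measured on shortest accepting runs. A shortest run is obtained here only up to double negation,
-- which is enough because non-simulation is itself a negation.

π₁ π₂ : ℕ → ℕ
π₁ n = proj₁ (unpair n)
π₂ n = proj₂ (unpair n)

triangle : ℕ → ℕ
triangle zero    = 0
triangle (suc n) = suc n + triangle n

diagonal : ℕ → ℕ
diagonal n = π₁ n + π₂ n

-- pair is abstract so that the codes of concrete instructions, which are
-- huge numbers, are never evaluated.
abstract
  pair : ℕ → ℕ → ℕ
  pair x y = triangle (x + y) + y

  pair-def : ∀ x y → pair x y ≡ triangle (x + y) + y
  pair-def x y = refl

-- Retraces the walk of `unpair` backwards: along a diagonal by lowering `y`, and from its first
-- point to the last point of the previous diagonal.
unpair-triangle : ∀ s x y → x + y ≡ s → unpair (triangle s + y) ≡ (x , y)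
unpair-triangle zero zero zero refl = refl
unpair-triangle (suc s) (suc x) zero eq
  rewrite +-identityʳ (s + triangle s) | +-comm s (triangle s)
        | unpair-triangle s 0 s refl
        | suc-injective (trans (cong suc (sym (+-identityʳ x))) eq) = refl
unpair-triangle s x (suc y) eq
  rewrite +-suc (triangle s) y
        | unpair-triangle s (suc x) y (trans (sym (+-suc x y)) eq) = refl

unpair-pair : ∀ x y → unpair (pair x y) ≡ (x , y)
unpair-pair x y = trans (cong unpair (pair-def x y)) (unpair-triangle (x + y) x y refl)

triangle-unpair : ∀ n → triangle (diagonal n) + π₂ n ≡ n
triangle-unpair zero = refl
triangle-unpair (suc n) with unpair n | triangle-unpair n
... | zero  , y | eq
  rewrite +-identityʳ y | +-identityʳ (y + triangle y) = cong suc (trans (+-comm y _) eq)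
... | suc x , y | eq rewrite +-suc x y = trans (+-suc _ y) (cong suc eq)

-- The walk changes to the next diagonal exactly when the first component is 0, and `1 ∸ π₁ n` is
-- the indicator of this. Both components can be recovered from `n` and its diagonal, so a recursion
-- carrying a single number suffices.
diagonal-suc : ∀ n → diagonal (suc n) ≡ diagonal n + (1 ∸ π₁ n)
diagonal-suc n with unpair n
... | zero  , y = trans (+-identityʳ (suc y)) (+-comm 1 y)
... | suc x , y = trans (+-suc x y) (trans (sym (+-identityʳ _)) (cong (suc (x + y) +_) (sym (0∸n≡0 x))))

π₂≡ : ∀ n → π₂ n ≡ n ∸ triangle (diagonal n)
π₂≡ n = sym (trans (cong (_∸ triangle (diagonal n)) (sym (triangle-unpair n)))
                   (m+n∸m≡n (triangle (diagonal n)) (π₂ n)))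

π₁≡ : ∀ n → π₁ n ≡ diagonal n ∸ π₂ n
π₁≡ n = sym (m+n∸n≡m (π₁ n) (π₂ n))

Computable : ∀ {n} → (Vec ℕ n → ℕ) → Set
Computable f = ∃[ e ] ∀ xs → e [ xs ]⇓ f xs

Computable₁ : (ℕ → ℕ) → Set
Computable₁ f = Computable {1} λ xs → f (lookup xs 0F)

Computable₂ : (ℕ → ℕ → ℕ) → Set
Computable₂ f = Computable {2} λ xs → f (lookup xs 0F) (lookup xs 1F)

computable-resp : ∀ {n} {f g : Vec ℕ n → ℕ} → (∀ xs → f xs ≡ g xs) → Computable f → Computable g
computable-resp eq (e , ev) = e , λ xs → subst (e [ xs ]⇓_) (eq xs) (ev xs)

var : ∀ {n} (i : Fin n) → Computable λ xs → lookup xs i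
var i = proj i , λ _ → proj

app₁ : ∀ {n} (f : ℕ → ℕ) {g : Vec ℕ n → ℕ} → Computable₁ f → Computable g → Computable λ xs → f (g xs)
app₁ _ (e , ev) (d , dv) = comp e (d ∷ []) , λ xs → comp (dv xs ∷ []) (ev _)

app₂ : ∀ {n} (f : ℕ → ℕ → ℕ) {g h : Vec ℕ n → ℕ} → Computable₂ f →
       Computable g → Computable h → Computable λ xs → f (g xs) (h xs)
app₂ _ (e , ev) (d , dv) (c , cv) = comp e (d ∷ c ∷ []) , λ xs → comp (dv xs ∷ cv xs ∷ []) (ev _)

sucᶜ : ∀ {n} {f : Vec ℕ n → ℕ} → Computable f → Computable λ xs → suc (f xs)
sucᶜ (e , ev) = comp suc (e ∷ []) , λ xs → comp (ev xs ∷ []) suc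

const : ∀ {n} c → Computable {n} λ _ → c
const zero    = comp zero [] , λ _ → comp [] zero
const (suc c) = sucᶜ (const c)

primRec : ∀ {n} {f : Vec ℕ (suc n) → ℕ} {base step} → Computable base → Computable step →
          (∀ xs → f (0 ∷ xs) ≡ base xs) →
          (∀ x xs → f (suc x ∷ xs) ≡ step (x ∷ f (x ∷ xs) ∷ xs)) →
          Computable f
primRec {f = f} (e , ev) (d , dv) f-zero f-suc = prec e d , λ { (x ∷ xs) → go x xs }
  where
  go : ∀ x xs → prec e d [ x ∷ xs ]⇓ f (x ∷ xs)
  go zero    xs = subst (_ [ _ ]⇓_) (sym (f-zero xs)) (prec-0 (ev xs))
  go (suc x) xs = subst (_ [ _ ]⇓_) (sym (f-suc x xs)) (prec-s (go x xs) (dv _))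

+-computable : Computable₂ _+_
+-computable = primRec (var 0F) (sucᶜ (var 1F)) (λ _ → refl) (λ _ _ → refl)

infixl 6 _+ᶜ_ _∸ᶜ_
_+ᶜ_ : ∀ {n} {f g : Vec ℕ n → ℕ} → Computable f → Computable g → Computable λ xs → f xs + g xs
_+ᶜ_ = app₂ _+_ +-computable

pred-computable : Computable₁ pred
pred-computable = primRec (const 0) (var 0F) (λ _ → refl) (λ _ _ → refl)

-- Primitive recursion runs over the first argument, so the subtrahend has to come first.
flip-∸-computable : Computable₂ λ m n → n ∸ m
flip-∸-computable = primRec (var 0F) (app₁ pred pred-computable (var 1F)) (λ _ → refl)
                      (λ { m (n ∷ []) → sym (pred[m∸n]≡m∸[1+n] n m) })

_∸ᶜ_ : ∀ {n} {f g : Vec ℕ n → ℕ} → Computable f → Computable g → Computable λ xs → f xs ∸ g xs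
f ∸ᶜ g = app₂ (λ m n → n ∸ m) flip-∸-computable g f

triangle-computable : Computable₁ triangle
triangle-computable = primRec (const 0) (sucᶜ (var 0F) +ᶜ var 1F) (λ _ → refl) (λ _ _ → refl)

pair-computable : Computable₂ pair
pair-computable = computable-resp (λ { (x ∷ y ∷ []) → sym (pair-def x y) })
                    (app₁ triangle triangle-computable (var 0F +ᶜ var 1F) +ᶜ var 1F)

diagonal-computable : Computable₁ diagonal
diagonal-computable =
  primRec (const 0)
    -- The available values are `n` and `diagonal n`; the nested differences compute `π₂ n` and then
    -- `π₁ n` from them.
    (var 1F +ᶜ (const 1 ∸ᶜ (var 1F ∸ᶜ (var 0F ∸ᶜ app₁ triangle triangle-computable (var 1F)))))
    (λ _ → refl)
    (λ { n [] → trans (diagonal-suc n) (cong (λ z → diagonal n + (1 ∸ z))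
                  (trans (π₁≡ n) (cong (diagonal n ∸_) (π₂≡ n)))) })

π₂-computable : Computable₁ π₂
π₂-computable = computable-resp (λ { (n ∷ []) → sym (π₂≡ n) })
                  (var 0F ∸ᶜ app₁ triangle triangle-computable (app₁ diagonal diagonal-computable (var 0F)))

π₁-computable : Computable₁ π₁
π₁-computable = computable-resp (λ { (n ∷ []) → sym (π₁≡ n) })
                  (app₁ diagonal diagonal-computable (var 0F) ∸ᶜ app₁ π₂ π₂-computable (var 0F))

pairᶜ : ∀ {n} {f g : Vec ℕ n → ℕ} → Computable f → Computable g → Computable λ xs → pair (f xs) (g xs)
pairᶜ = app₂ pair pair-computable

π₁ᶜ : ∀ {n} {f : Vec ℕ n → ℕ} → Computable f → Computable λ xs → π₁ (f xs)
π₁ᶜ = app₁ π₁ π₁-computable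

π₂ᶜ : ∀ {n} {f : Vec ℕ n → ℕ} → Computable f → Computable λ xs → π₂ (f xs)
π₂ᶜ = app₁ π₂ π₂-computable

dropCode : ℕ → ℕ → ℕ
dropCode zero    n = n
dropCode (suc j) n = π₂ (dropCode j n)

entry : ℕ → ℕ → ℕ
entry j n = π₁ (dropCode j n)

entry-computable : Computable₂ entry
entry-computable = π₁ᶜ (primRec {f = λ xs → dropCode (lookup xs 0F) (lookup xs 1F)}
                     (var 0F) (π₂ᶜ (var 1F)) (λ _ → refl) (λ _ _ → refl))

-- Recursion on the number of entries puts the entry with the largest index in front; hence
-- `reverse` and `applyDownFrom` in the programs below.
prepend : (ℕ → ℕ) → ℕ → ℕ → ℕ
prepend f zero    n = n
prepend f (suc k) n = pair (f k) (prepend f k n)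

prepend-computable : ∀ {f : ℕ → ℕ → ℕ} {k base} →
  Computable₂ f → Computable₁ k → Computable₁ base →
  Computable₁ λ a → prepend (λ j → f j a) (k a) (base a)
prepend-computable {f} {base = base} fᶜ kᶜ baseᶜ = app₂ (λ n a → prepend (λ j → f j a) n (base a))
  (primRec {f = λ xs → prepend (λ j → f j (lookup xs 1F)) (lookup xs 0F) (base (lookup xs 1F))}
    baseᶜ (pairᶜ (app₂ f fᶜ (var 0F) (var 2F)) (var 1F)) (λ _ → refl) (λ _ _ → refl))
  kᶜ (var 0F)

-- Codes of programs

encodeSym : Sym → ℕ
encodeSym blank            = 0
encodeSym (bit zero)       = 1
encodeSym (bit (suc zero)) = 2
encodeSym (aux n)          = 3 + n

decode-encodeSym : ∀ s → decodeSym (encodeSym s) ≡ s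
decode-encodeSym blank            = refl
decode-encodeSym (bit zero)       = refl
decode-encodeSym (bit (suc zero)) = refl
decode-encodeSym (aux _)          = refl

encodeMaybeSym : Maybe Sym → ℕ
encodeMaybeSym nothing  = 0
encodeMaybeSym (just s) = suc (encodeSym s)

decode-encodeMaybeSym : ∀ s → decodeMaybeSym (encodeMaybeSym s) ≡ s
decode-encodeMaybeSym nothing  = refl
decode-encodeMaybeSym (just s) = cong just (decode-encodeSym s)

encodeMove : Move → ℕ
encodeMove stay  = 0
encodeMove left  = 1
encodeMove right = 2

decode-encodeMove : ∀ m → decodeMove (encodeMove m) ≡ m
decode-encodeMove stay  = refl
decode-encodeMove left  = refl
decode-encodeMove right = refl

encodeState : State → ℕ
encodeState halt    = 0
encodeState (run q) = suc q

decode-encodeState : ∀ q → decodeState (encodeState q) ≡ q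
decode-encodeState halt    = refl
decode-encodeState (run _) = refl

encodeAction : Action → ℕ
encodeAction (action r w m) = pair (encodeMaybeSym r) (pair (encodeMaybeSym w) (encodeMove m))

decode-encodeAction : ∀ α → decodeAction (encodeAction α) ≡ α
decode-encodeAction (action r w m)
  rewrite unpair-pair (encodeMaybeSym r) (pair (encodeMaybeSym w) (encodeMove m))
        | unpair-pair (encodeMaybeSym w) (encodeMove m)
        | decode-encodeMaybeSym r | decode-encodeMaybeSym w | decode-encodeMove m = refl

-- The length is left out, as `decodeList` expects it separately; so further entries can be put in
-- front of an existing code.
encodeList : ∀ {A : Set} → (A → ℕ) → List A → ℕ
encodeList f []       = 0
encodeList f (x ∷ xs) = pair (f x) (encodeList f xs)

decodeVec-pair : ∀ {A : Set} (d : ℕ → A) k x n →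
  decodeVec d (suc k) (pair x n) ≡ d x ∷ decodeVec d k n
decodeVec-pair d k x n rewrite unpair-pair x n = refl

decodeVec-encodeList : ∀ {A B : Set} (d : ℕ → B) (e : A → ℕ) {f : A → B} →
  (∀ x → d (e x) ≡ f x) → ∀ xs → Vec.toList (decodeVec d (length xs) (encodeList e xs)) ≡ map f xs
decodeVec-encodeList d e eq [] = refl
decodeVec-encodeList d e eq (x ∷ xs)
  rewrite unpair-pair (e x) (encodeList e xs) = cong₂ _∷_ (eq x) (decodeVec-encodeList d e eq xs)

decodeVec-prepend : ∀ {A : Set} (d : ℕ → A) f k {m n} →
  Vec.toList (decodeVec d (k + m) (prepend f k n)) ≡
  applyDownFrom (d ∘ f) k ++ Vec.toList (decodeVec d m n)
decodeVec-prepend d f zero = refl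
decodeVec-prepend d f (suc k) {n = n}
  rewrite unpair-pair (f k) (prepend f k n) = cong (d (f k) ∷_) (decodeVec-prepend d f k)

dropCode-π₂ : ∀ j n → dropCode j (π₂ n) ≡ dropCode (suc j) n
dropCode-π₂ zero    n = refl
dropCode-π₂ (suc j) n = cong π₂ (dropCode-π₂ j n)

applyUpTo-cong : ∀ {A : Set} {f g : ℕ → A} → (∀ j → f j ≡ g j) → ∀ k → applyUpTo f k ≡ applyUpTo g k
applyUpTo-cong eq zero    = refl
applyUpTo-cong eq (suc k) = cong₂ _∷_ (eq 0) (applyUpTo-cong (eq ∘ suc) k)

decodeVec-entries : ∀ {A : Set} (d : ℕ → A) k n →
  Vec.toList (decodeVec d k n) ≡ applyUpTo (λ j → d (entry j n)) k
decodeVec-entries d zero    n = refl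
decodeVec-entries d (suc k) n = cong (d (π₁ n) ∷_)
  (trans (decodeVec-entries d k (π₂ n)) (applyUpTo-cong (λ j → cong (d ∘ π₁) (dropCode-π₂ j n)) k))

-- Turns an operation `f` on the codes of single instructions into the operation `g` on all
-- instructions of a program.
decodeVec-prepend-entries : ∀ {A B : Set} (d : ℕ → A) (d′ : ℕ → B) (f : ℕ → ℕ) {g : A → B} →
  (∀ x → d′ (f x) ≡ g (d x)) → ∀ k body {m n} →
  Vec.toList (decodeVec d′ (k + m) (prepend (λ j → f (entry j body)) k n)) ≡
  reverse (map g (Vec.toList (decodeVec d k body))) ++ Vec.toList (decodeVec d′ m n)
decodeVec-prepend-entries d d′ f {g} eq k body {m} {n} =
  trans (decodeVec-prepend d′ (λ j → f (entry j body)) k)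
    (cong (_++ Vec.toList (decodeVec d′ m n)) (begin
      applyDownFrom (λ j → d′ (f (entry j body))) k         ≡⟨ reverse-applyUpTo _ k ⟨
      reverse (applyUpTo (λ j → d′ (f (entry j body))) k)   ≡⟨ cong reverse (applyUpTo-cong (λ j → eq (entry j body)) k) ⟩
      reverse (applyUpTo (λ j → g (d (entry j body))) k)    ≡⟨ cong reverse (map-applyUpTo _ g k) ⟨
      reverse (map g (applyUpTo (λ j → d (entry j body)) k)) ≡⟨ cong (reverse ∘ map g) (decodeVec-entries d k body) ⟨
      reverse (map g (Vec.toList (decodeVec d k body)))     ∎))
  where open ≡-Reasoning

idle : Action
idle = action nothing nothing stay

pad : ∀ k → List Action → Vec Action k
pad zero    _        = []
pad (suc k) []       = idle ∷ pad k []
pad (suc k) (α ∷ αs) = α ∷ pad k αs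

-- The idle action has code 0 and so has every vector of idle actions; this
-- makes the code of a template independent of the number of tapes.
decodeVec-actions : ∀ k αs → decodeVec decodeAction k (encodeList encodeAction αs) ≡ pad k αs
decodeVec-actions zero    αs = refl
decodeVec-actions (suc k) [] = cong (idle ∷_) (decodeVec-actions k [])
decodeVec-actions (suc k) (α ∷ αs) =
  trans (decodeVec-pair decodeAction k (encodeAction α) _)
        (cong₂ _∷_ (decode-encodeAction α) (decodeVec-actions k αs))

-- The added instructions act on the first one or two tapes only, whereas the number of tapes varies
-- with the given machine.
record Template : Set where
  constructor template
  field
    from    : ℕ
    to      : State
    actions : List Action

realize : ∀ k → Template → Instruction k
realize k (template q r αs) = instruction q r (pad k αs)

encodeInstruction : ℕ → ℕ → ℕ → ℕ
encodeInstruction q r αs = pair q (pair r αs)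

decode-encodeInstruction : ∀ k q r αs →
  decodeInstruction k (encodeInstruction q r αs) ≡
  instruction q (decodeState r) (decodeVec decodeAction k αs)
decode-encodeInstruction k q r αs
  rewrite unpair-pair q (pair r αs) | unpair-pair r αs = refl

encodeTemplate : Template → ℕ
encodeTemplate (template q r αs) =
  encodeInstruction q (encodeState r) (encodeList encodeAction αs)

decode-encodeTemplate : ∀ k τ → decodeInstruction k (encodeTemplate τ) ≡ realize k τ
decode-encodeTemplate k (template q r αs) =
  trans (decode-encodeInstruction k q (encodeState r) (encodeList encodeAction αs))
        (cong₂ (instruction q) (decode-encodeState r) (decodeVec-actions k αs))

-- The simulated machine continues in state d instead of halting.
shiftState : ℕ → State → State
shiftState d halt    = run d
shiftState d (run q) = run (suc d + q)

-- The states up to `d` are reserved for the new instructions, so the simulated start state becomes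
-- `suc d`.
embed : ∀ d {j k} → (Vec Action j → Vec Action k) → Instruction j → Instruction k
embed d extend (instruction q r αs) = instruction (suc d + q) (shiftState d r) (extend αs)

-- Since `halt` has code 0 and `run q` has code `suc q`, adding `suc d` to the code of the target
-- performs both cases of `shiftState`.
embedCode : ℕ → (ℕ → ℕ) → ℕ → ℕ
embedCode d extend n =
  encodeInstruction (suc d + π₁ n) (suc d + π₁ (π₂ n)) (extend (π₂ (π₂ n)))

decode-shiftState : ∀ d r → decodeState (suc d + r) ≡ shiftState d (decodeState r)
decode-shiftState d zero    = cong run (+-identityʳ d)
decode-shiftState d (suc q) = cong run (+-suc d q)

decode-embedCode : ∀ d {j k} {extend : Vec Action j → Vec Action k} {extendCode} →
  (∀ n → decodeVec decodeAction k (extendCode n) ≡ extend (decodeVec decodeAction j n)) →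
  ∀ n → decodeInstruction k (embedCode d extendCode n) ≡ embed d extend (decodeInstruction j n)
decode-embedCode d {k = k} eq n =
  trans (decode-encodeInstruction k _ _ _)
        (cong₂ (instruction (suc d + π₁ n)) (decode-shiftState d _) (eq _))

encodeInstructionᶜ : ∀ {n} {q r αs : Vec ℕ n → ℕ} → Computable q → Computable r → Computable αs →
  Computable λ xs → encodeInstruction (q xs) (r xs) (αs xs)
encodeInstructionᶜ q r αs = pairᶜ q (pairᶜ r αs)

decodeMachine-pair : ∀ k len body →
  decodeMachine (pair k (pair len body)) ≡
  machine k (Vec.toList (decodeVec (decodeInstruction (suc k)) len body))
decodeMachine-pair k len body rewrite unpair-pair k (pair len body) | unpair-pair len body = refl

tapesCode lengthCode bodyCode : ℕ → ℕ
tapesCode  a = π₁ a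
lengthCode a = π₁ (π₂ a)
bodyCode   a = π₂ (π₂ a)

-- The acceptor guessing a preimage

wordTape : List Sym → Word → Tape
wordTape l []      = tape l blank []
wordTape l (b ∷ w) = tape l (bit b) (map bit w)

inputTape≡wordTape : ∀ w → inputTape w ≡ wordTape [] w
inputTape≡wordTape []      = refl
inputTape≡wordTape (_ ∷ _) = refl

shift-right-wordTape : ∀ l b w → shift right (wordTape l (b ∷ w)) ≡ wordTape (bit b ∷ l) w
shift-right-wordTape l b []      = refl
shift-right-wordTape l b (_ ∷ _) = refl

reads-[]⁺ : ∀ t → Tape.scanned t ≡ blank → Reads t []
reads-[]⁺ _ refl = _ , refl

reads-[]⁻ : ∀ t → Reads t [] → Tape.scanned t ≡ blank
reads-[]⁻ _ (_ , refl) = refl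

reads-∷⁺ : ∀ t {b w} → Tape.scanned t ≡ bit b → Reads (shift right t) w → Reads t (b ∷ w)
reads-∷⁺ (tape _ _ [])      {w = []}    refl _        = [] , refl
reads-∷⁺ (tape _ _ [])      {w = _ ∷ _} refl (_ , ())
reads-∷⁺ (tape _ _ (_ ∷ _)) {b}         refl (z , eq) = z , cong (bit b ∷_) eq

reads-∷⁻ : ∀ t {b w} → Reads t (b ∷ w) → Tape.scanned t ≡ bit b × Reads (shift right t) w
reads-∷⁻ (tape _ _ [])      {w = []}    (_ , refl) = refl , _ , refl
reads-∷⁻ (tape _ _ [])      {w = _ ∷ _} (_ , ())
reads-∷⁻ (tape _ _ (_ ∷ _))             (z , eq)   = proj₁ (∷-injective eq) , z , proj₂ (∷-injective eq)

reads-unique : ∀ t y y′ → Reads t y → Reads t y′ → y ≡ y′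
reads-unique t []      []        _ _  = refl
reads-unique t []      (_ ∷ _)   ρ ρ′ with () ← trans (sym (reads-[]⁻ t ρ)) (proj₁ (reads-∷⁻ t ρ′))
reads-unique t (_ ∷ _) []        ρ ρ′ with () ← trans (sym (reads-[]⁻ t ρ′)) (proj₁ (reads-∷⁻ t ρ))
reads-unique t (b ∷ y) (b′ ∷ y′) ρ ρ′ with reads-∷⁻ t ρ | reads-∷⁻ t ρ′
... | eq , σ | eq′ , σ′ with refl ← trans (sym eq) eq′ = cong (b ∷_) (reads-unique (shift right t) y y′ σ σ′)

act-idle : ∀ {k} (ts : Vec Tape k) → Vec.zipWith act (pad k []) ts ≡ ts
act-idle []       = refl
act-idle (t ∷ ts) = cong (t ∷_) (act-idle ts)

matches-idle : ∀ {k} (ts : Vec Tape k) → Pointwise Matches (pad k []) ts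
matches-idle []       = []
matches-idle (t ∷ ts) = Maybe.nothing ∷ matches-idle ts

infixr 5 _◅◅_
_◅◅_ : ∀ {M m n c d e} → Steps M m c d → Steps M n d e → Steps M (m + n) c e
done     ◅◅ τs = τs
(σ ◅ σs) ◅◅ τs = σ ◅ (σs ◅◅ τs)

pairwise : ∀ {A : Set} {R : A → A → Set} {xs x y} → AllPairs R xs →
           x ∈ xs → y ∈ xs → x ≡ y ⊎ (R x y ⊎ R y x)
pairwise _        (here refl) (here refl) = inj₁ refl
pairwise (rs ∷ _) (here refl) (there y∈)  = inj₂ (inj₁ (All.lookup rs y∈))
pairwise (rs ∷ _) (there x∈)  (here refl) = inj₂ (inj₂ (All.lookup rs x∈))
pairwise (_ ∷ ps) (there x∈)  (there y∈)  = pairwise ps x∈ y∈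

compatible : ∀ {α β t} → Matches α t → Matches β t → Compatible (Action.reads α) (Action.reads β)
compatible Maybe.nothing     _                 = anyˡ
compatible (Maybe.just _)    Maybe.nothing     = anyʳ
compatible (Maybe.just refl) (Maybe.just refl) = same

compatibles : ∀ {k} {αs βs : Vec Action k} {ts : Vec Tape k} → Pointwise Matches αs ts → Pointwise Matches βs ts →
  Pointwise (λ α β → Compatible (Action.reads α) (Action.reads β)) αs βs
compatibles []       []       = []
compatibles {αs = α ∷ _} {β ∷ _} {t ∷ _} (α≈ ∷ αs≈) (β≈ ∷ βs≈) = compatible {α} {β} {t} α≈ β≈ ∷ compatibles αs≈ βs≈

step-unique : ∀ {M c d d′} → Deterministic M → Step M c d → Step M c d′ → d ≡ d′
step-unique det (step i∈ αs≈) (step j∈ βs≈) with pairwise det i∈ j∈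
... | inj₁ refl             = refl
... | inj₂ (inj₁ ¬overlap) = contradiction (refl , compatibles αs≈ βs≈) ¬overlap
... | inj₂ (inj₂ ¬overlap) = contradiction (refl , compatibles βs≈ αs≈) ¬overlap

halting-unique : ∀ {M m n c ts ts′} → Deterministic M →
  Steps M m c (config halt ts) → Steps M n c (config halt ts′) → ts ≡ ts′
halting-unique det done        done        = refl
halting-unique det done        (() ◅ _)
halting-unique det (() ◅ _)    done
halting-unique det (σ ◅ σs)    (τ ◅ τs) with refl ← step-unique det σ τ = halting-unique det σs τs

-- Identifies the output of a halting run found by the guessing acceptor with the value of the proof
-- system.
output-unique : ∀ (T : Transducer) {x m n y y′} → Outputs T x m y → Outputs T x n y′ → y ≡ y′
output-unique T (t , _ , σs , ρ) (_ , _ , τs , ρ′)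
  with refl ← halting-unique (Transducer.deterministic T) σs τs = reads-unique t _ _ ρ ρ′

GuessRule : Set
GuessRule = ℕ × State × Action × Action

guessTemplate : GuessRule → Template
guessTemplate (q , r , α , β) = template q r (α ∷ β ∷ [])

go : Move → Action
go m = action nothing nothing m

put : Sym → Action
put s = action nothing (just s) stay

on : Sym → Move → Action
on s m = action (just s) nothing m

-- A word is guessed from right to left (states 0 to 2), so that the head
-- ends up on its first letter with nothing stored before it.  State 3
-- compares the output of the simulated machine with the input.
guessRules : List GuessRule
guessRules =
  (0 , run 4 , idle , idle) ∷
  (0 , run 1 , idle , put (bit 0b)) ∷
  (0 , run 1 , idle , put (bit 1b)) ∷
  (1 , run 4 , idle , idle) ∷
  (1 , run 2 , idle , go left) ∷
  (2 , run 1 , idle , put (bit 0b)) ∷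
  (2 , run 1 , idle , put (bit 1b)) ∷
  (3 , run 3 , on (bit 0b) right , on (bit 0b) right) ∷
  (3 , run 3 , on (bit 1b) right , on (bit 1b) right) ∷
  (3 , halt  , on blank stay , on blank stay) ∷ []

-- An indexed form of the list of rules: pattern matching on it leaves only the rules of the current
-- state.
data Guess : ℕ → State → Action → Action → Set where
  none   : Guess 0 (run 4) idle idle
  first  : ∀ b → Guess 0 (run 1) idle (put (bit b))
  finish : Guess 1 (run 4) idle idle
  extend : Guess 1 (run 2) idle (go left)
  next   : ∀ b → Guess 2 (run 1) idle (put (bit b))
  agree  : ∀ b → Guess 3 (run 3) (on (bit b) right) (on (bit b) right)
  end    : Guess 3 halt (on blank stay) (on blank stay)

rule⁺ : ∀ {q r α β} → Guess q r α β → (q , r , α , β) ∈ guessRules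
rule⁺ none             = here refl
rule⁺ (first zero)     = there (here refl)
rule⁺ (first (suc zero)) = there (there (here refl))
rule⁺ finish           = there (there (there (here refl)))
rule⁺ extend           = there (there (there (there (here refl))))
rule⁺ (next zero)      = there (there (there (there (there (here refl)))))
rule⁺ (next (suc zero)) = there (there (there (there (there (there (here refl))))))
rule⁺ (agree zero)     = there (there (there (there (there (there (there (here refl)))))))
rule⁺ (agree (suc zero)) = there (there (there (there (there (there (there (there (here refl))))))))
rule⁺ end              = there (there (there (there (there (there (there (there (there (here refl)))))))))

rule⁻ : ∀ {q r α β} → (q , r , α , β) ∈ guessRules → Guess q r α β
rule⁻ = All.lookup rules
  where
  rules : All (λ (q , r , α , β) → Guess q r α β) guessRules
  rules = none ∷ first 0b ∷ first 1b ∷ finish ∷ extend ∷ next 0b ∷ next 1b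
    ∷ agree 0b ∷ agree 1b ∷ end ∷ []

-- The new first tape keeps the input. The simulated machine works on the remaining tapes, the first
-- of which receives the guess.
guesser : Machine → Machine
guesser (machine k P) = machine (suc k)
  (reverse (map (embed 3 (idle ∷_)) P) ++ map (realize (suc (suc k))) (map guessTemplate guessRules))

module Guesser (k : ℕ) (P : Program (suc k)) where

  M G : Machine
  M = machine k P
  G = guesser M

  -- Inversion of a step of `G`. Guessing and comparing use the states 0 to 3 and the simulation
  -- those from 4 on, so the state decides the case.
  data View (ts : Vec Tape (suc k)) (t : Tape) : ℕ → Config (suc (suc k)) → Set where
    simulated : ∀ {q r ts′} → Step M (config (run q) ts) (config r ts′) →
                View ts t (4 + q) (config (shiftState 3 r) (t ∷ ts′))
    guessing  : ∀ {q r α β u us} → ts ≡ u ∷ us → Guess q r α β →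
                Matches α t → Matches β u →
                View ts t q (config r (act α t ∷ act β u ∷ us))

  view : ∀ {q t ts d} → Step G (config (run q) (t ∷ ts)) d → View ts t q d
  view {ts = u ∷ us} (step {as = as} i∈ αs≈) with ∈-++⁻ (reverse (map (embed 3 (idle ∷_)) P)) i∈
  view (step i∈ (_ ∷ αs≈)) | inj₁ i∈₁
    with ∈-map⁻ (embed 3 (idle ∷_)) {xs = P} (reverse⁻ {xs = map (embed 3 (idle ∷_)) P} i∈₁)
  ... | instruction q r αs , j∈ , refl = simulated (step j∈ αs≈)
  view {ts = u ∷ us} (step i∈ αs≈) | inj₂ i∈₂
    with ∈-map⁻ (realize (suc (suc k))) {xs = map guessTemplate guessRules} i∈₂
  ... | _ , τ∈ , refl with ∈-map⁻ guessTemplate {xs = guessRules} τ∈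
  view {ts = u ∷ us} (step i∈ (α≈ ∷ β≈ ∷ _)) | inj₂ i∈₂ | _ , τ∈ , refl | _ , ρ∈ , refl
    rewrite act-idle us = guessing refl (rule⁻ ρ∈) α≈ β≈

  step-simulated : ∀ {q r t ts ts′} → Step M (config (run q) ts) (config r ts′) →
    Step G (config (run (4 + q)) (t ∷ ts)) (config (shiftState 3 r) (t ∷ ts′))
  step-simulated (step {as = αs} i∈ αs≈) =
    step {as = idle ∷ αs} (∈-++⁺ˡ (reverse⁺ (∈-map⁺ (embed 3 (idle ∷_)) i∈))) (Maybe.nothing ∷ αs≈)

  step-guessing : ∀ {q r α β t u us} → Guess q r α β → Matches α t → Matches β u →
    Step G (config (run q) (t ∷ u ∷ us)) (config r (act α t ∷ act β u ∷ us))
  step-guessing {q} {r} {α} {β} {t} {u} {us} γ α≈ β≈ =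
    subst (λ vs → Step G (config (run q) (t ∷ u ∷ us)) (config r (act α t ∷ act β u ∷ vs))) (act-idle us)
      (step (∈-++⁺ʳ (reverse (map (embed 3 (idle ∷_)) P)) (∈-map⁺ (realize (suc (suc k))) (∈-map⁺ guessTemplate (rule⁺ γ))))
            (α≈ ∷ β≈ ∷ matches-idle us))

  compare⁻ : ∀ {n ts} l w u us → Steps G n (config (run 3) (wordTape l w ∷ u ∷ us)) (config halt ts) →
             Reads u w
  compare⁻ l w u us (σ ◅ σs) with view σ
  compare⁻ l (b ∷ w) u us (σ ◅ σs) | guessing refl (agree b) (Maybe.just refl) (Maybe.just refl)
    rewrite shift-right-wordTape l b w = reads-∷⁺ u refl (compare⁻ _ w _ us σs)
  compare⁻ l [] u us (σ ◅ σs)      | guessing refl end (Maybe.just refl) (Maybe.just refl) = reads-[]⁺ u refl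
  compare⁻ l (_ ∷ _) u us (σ ◅ σs) | guessing refl end (Maybe.just ()) _

  simulate⁻ : ∀ {n q t ts us} → Steps G n (config (run (4 + q)) (t ∷ ts)) (config halt us) →
    ∃[ ts′ ] (∃[ m ] Steps M m (config (run q) ts) (config halt ts′)) ×
             (∃[ m ] Steps G m (config (run 3) (t ∷ ts′)) (config halt us))
  simulate⁻ (σ ◅ σs) with view σ
  simulate⁻ (σ ◅ σs) | simulated {r = halt} τ = _ , (1 , τ ◅ done) , (_ , σs)
  simulate⁻ (σ ◅ σs) | simulated {r = run _} τ with simulate⁻ σs
  ... | _ , (_ , τs) , υs = _ , (_ , τ ◅ τs) , υs

  Produces : Word → Set
  Produces x = ∃[ y ] ∃[ n ] ∃[ t ] ∃[ ts ] Steps M n (initial M y) (config halt (t ∷ ts)) × Reads t x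

  produces : ∀ {n ts} x y →
            Steps G n (config (run 4) (inputTape x ∷ Config.tapes (initial M y))) (config halt ts) →
             Produces x
  produces x y σs with simulate⁻ σs
  ... | t ∷ ts , (_ , τs) , (_ , υs) rewrite inputTape≡wordTape x =
    y , _ , t , ts , τs , compare⁻ [] x t ts υs

  blanks : Vec Tape k
  blanks = Vec.replicate k emptyTape

  -- In state 1 the head stands on the first letter of a nonempty guess, in state 2 on the blank
  -- before the part guessed so far.
  guess₁⁻ : ∀ {n ts} x b w →
            Steps G n (config (run 1) (inputTape x ∷ inputTape (b ∷ w) ∷ blanks)) (config halt ts) →
            Produces x
  guess₂⁻ : ∀ {n ts} x w →
            Steps G n (config (run 2) (inputTape x ∷ tape [] blank (map bit w) ∷ blanks)) (config halt ts) →
            Produces x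
  guess₁⁻ x b w (σ ◅ σs) with view σ
  ... | guessing refl finish _ _   = produces x (b ∷ w) σs
  ... | guessing refl extend _ _   = guess₂⁻ x (b ∷ w) σs
  guess₂⁻ x w (σ ◅ σs) with view σ
  ... | guessing refl (next b) _ _ = guess₁⁻ x b w σs

  sound : ∀ {x} → Accepts G x → Produces x
  sound {x} (_ , _ , σ ◅ σs) with view σ
  ... | guessing refl none _ _      = produces x [] σs
  ... | guessing refl (first b) _ _ = guess₁⁻ x b [] σs

  compare⁺ : ∀ l w u us → Reads u w →
    ∃[ ts ] Steps G (suc (length w)) (config (run 3) (wordTape l w ∷ u ∷ us)) (config halt ts)
  compare⁺ l [] u@(tape _ _ _) us ρ with refl ← reads-[]⁻ u ρ =
    _ , step-guessing end (Maybe.just refl) (Maybe.just refl) ◅ done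
  compare⁺ l (b ∷ w) u@(tape _ _ _) us ρ with reads-∷⁻ u ρ
  ... | refl , ρ′ with compare⁺ (bit b ∷ l) w (shift right u) us ρ′
  ... | ts , σs rewrite sym (shift-right-wordTape l b w) =
    ts , step-guessing (agree b) (Maybe.just refl) (Maybe.just refl) ◅ σs

  -- The step count is unchanged because the last simulated step itself enters state 3.
  simulate⁺ : ∀ {n q t ts us} → Steps M n (config (run q) ts) (config halt us) →
              Steps G n (config (run (4 + q)) (t ∷ ts)) (config (run 3) (t ∷ us))
  simulate⁺ (σ@(step {r = halt}  _ _) ◅ done)     = step-simulated σ ◅ done
  simulate⁺ (σ@(step {r = halt}  _ _) ◅ (() ◅ _))
  simulate⁺ (σ@(step {r = run _} _ _) ◅ σs)       = step-simulated σ ◅ simulate⁺ σs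

  guess⁺ : ∀ x b w → Steps G (suc (length w * 2)) (initial G x)
                       (config (run 1) (inputTape x ∷ inputTape (b ∷ w) ∷ blanks))
  guess⁺ x b []      = step-guessing (first b) Maybe.nothing Maybe.nothing ◅ done
  guess⁺ x b (c ∷ w) = subst (λ n → Steps G n (initial G x) (config (run 1) (inputTape x ∷ inputTape (b ∷ c ∷ w) ∷ blanks)))
    (+-comm _ 2)
    (guess⁺ x c w ◅◅ step-guessing extend Maybe.nothing Maybe.nothing
                  ◅ (step-guessing (next b) Maybe.nothing Maybe.nothing ◅ done))

  -- A nonempty `y` takes twice its length in steps; the additional 1 covers the single step for the
  -- empty word.
  guessed : ∀ x y → ∃[ n ] n ≤ suc (length y * 2) ×
    Steps G n (initial G x) (config (run 4) (inputTape x ∷ Config.tapes (initial M y)))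
  guessed x []      = 1 , ≤-refl , step-guessing none Maybe.nothing Maybe.nothing ◅ done
  guessed x (b ∷ w) = _ , ≤-trans (≤-reflexive (+-comm (suc (length w * 2)) 1)) (n≤1+n _) ,
    guess⁺ x b w ◅◅ step-guessing finish Maybe.nothing Maybe.nothing ◅ done

  complete : ∀ {x y n t ts} → Steps M n (initial M y) (config halt (t ∷ ts)) → Reads t x →
             ∃[ m ] m ≤ suc (length y * 2) + (n + suc (length x)) × AcceptsIn G x m
  complete {x} {y} {n} {t} {ts} σs ρ with guessed x y | compare⁺ [] x t ts ρ
  ... | m , m≤ , gs | us , cs rewrite sym (inputTape≡wordTape x) =
    m + (n + suc (length x)) , +-monoˡ-≤ _ m≤ , us , gs ◅◅ simulate⁺ σs ◅◅ cs

-- The transducer with short proofs of 0^i 1 0^j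

-- The erased first letter of an input 1z leaves a blank before the head that is
-- absent from the input tape of z.
data Padded : Tape → Tape → Set where
  equal  : ∀ {t} → Padded t t
  padded : ∀ {l s r} → Padded (tape l s r) (tape (l ++ [ blank ]) s r)

act-padded : ∀ α {t u} → Padded t u → Padded (act α t) (act α u)
act-padded _                  equal                 = equal
act-padded (action _ _ stay)  padded                = padded
-- The move uses up the extra blank, while the other tape supplies a fresh blank in its place.
act-padded (action _ _ left)  (padded {[]})         = equal
act-padded (action _ _ left)  (padded {_ ∷ _})      = padded
act-padded (action _ _ right) (padded {r = []})     = padded
act-padded (action _ _ right) (padded {r = _ ∷ _})  = padded

matches-padded : ∀ α {t u} → Padded t u → Matches α t → Matches α u
matches-padded _ equal  α≈ = α≈
matches-padded _ padded α≈ = α≈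

reads-padded : ∀ {t u} y → Padded t u → Reads t y → Reads u y
reads-padded _ equal  ρ = ρ
reads-padded _ padded ρ = ρ

rewriting : Sym → Sym → Move → Action
rewriting s u m = action (just s) (just u) m

-- An input 1z is passed on to the simulated machine, whose states are the
-- numbers from 5 + i on.  On any other input w all letters are replaced by
-- zeros (state 1), and 0^i 1 is written in front of them from right to left
-- (states 2 and 3 + i down to 3).
modeRules : ℕ → List (ℕ × State × Action)
modeRules i =
  (0 , run (5 + i) , rewriting (bit 1b) blank right) ∷
  (0 , run 1 , on (bit 0b) stay) ∷
  (0 , run 1 , on blank stay) ∷
  (1 , run 1 , rewriting (bit 0b) (bit 0b) right) ∷
  (1 , run 1 , rewriting (bit 1b) (bit 0b) right) ∷
  (1 , run 2 , on blank left) ∷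
  (2 , run 2 , on (bit 0b) left) ∷
  (2 , run (3 + i) , rewriting blank (bit 1b) left) ∷
  (3 , halt , go right) ∷
  (4 + i , halt , idle) ∷ []

data Mode (i : ℕ) : ℕ → State → Action → Set where
  simulate : Mode i 0 (run (5 + i)) (rewriting (bit 1b) blank right)
  generate : Mode i 0 (run 1) (on (bit 0b) stay)
  empty    : Mode i 0 (run 1) (on blank stay)
  clear    : ∀ b → Mode i 1 (run 1) (rewriting (bit b) (bit 0b) right)
  turn     : Mode i 1 (run 2) (on blank left)
  back     : Mode i 2 (run 2) (on (bit 0b) left)
  one      : Mode i 2 (run (3 + i)) (rewriting blank (bit 1b) left)
  finish   : Mode i 3 halt (go right)
  output   : Mode i (4 + i) halt idle

mode⁺ : ∀ {i q r α} → Mode i q r α → (q , r , α) ∈ modeRules i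
mode⁺ simulate     = here refl
mode⁺ generate     = there (here refl)
mode⁺ empty        = there (there (here refl))
mode⁺ (clear zero) = there (there (there (here refl)))
mode⁺ (clear (suc zero)) = there (there (there (there (here refl))))
mode⁺ turn         = there (there (there (there (there (here refl)))))
mode⁺ back         = there (there (there (there (there (there (here refl))))))
mode⁺ one          = there (there (there (there (there (there (there (here refl)))))))
mode⁺ finish       = there (there (there (there (there (there (there (there (here refl))))))))
mode⁺ output       = there (there (there (there (there (there (there (there (there (here refl)))))))))

oneTape : ℕ × State × Action → Template
oneTape (q , r , α) = template q r (α ∷ [])

-- The program itself contains the number `i`, in the form of one state for each leading zero to be
-- written.
zeroRule : ℕ → Template
zeroRule j = oneTape (4 + j , run (3 + j) , action nothing (just (bit 0b)) left)

simulatedPart : ℕ → ∀ k → Program (suc k) → Program (suc k)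
simulatedPart i k P = reverse (map (embed (4 + i) id) P)

zerosPart modesPart : ℕ → ∀ k → Program (suc k)
zerosPart i k = applyDownFrom (realize (suc k) ∘ zeroRule) i
modesPart i k = map (realize (suc k)) (map oneTape (modeRules i))

jumper : ℕ → Machine → Machine
jumper i (machine k P) = machine k (simulatedPart i k P ++ (zerosPart i k ++ modesPart i k))

zeros : ℕ → List Sym
zeros n = replicate n (bit 0b)

replicate-++-∷ : ∀ {A : Set} n (x : A) xs → replicate n x ++ x ∷ xs ≡ x ∷ replicate n x ++ xs
replicate-++-∷ zero    x xs = refl
replicate-++-∷ (suc n) x xs = cong (x ∷_) (replicate-++-∷ n x xs)

generated : ℕ → Word → Word
generated i w = 0^ i 1· replicate (length w) 0b

RunsTo : Machine → Word → ℕ → Word → Set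
RunsTo M x n y = ∃[ t ] ∃[ ts ] Steps M n (initial M x) (config halt (t ∷ ts)) × Reads t y

module Jumper (i k : ℕ) (P : Program (suc k)) where

  M J : Machine
  M = machine k P
  J = jumper i M

  step-template : ∀ {q r α t ts} → realize (suc k) (oneTape (q , r , α)) ∈ Machine.program J →
    Matches α t → Step J (config (run q) (t ∷ ts)) (config r (act α t ∷ ts))
  step-template {q} {r} {α} {t} {ts} τ∈ α≈ =
    subst (λ us → Step J (config (run q) (t ∷ ts)) (config r (act α t ∷ us))) (act-idle ts)
      (step τ∈ (α≈ ∷ matches-idle ts))

  step-mode : ∀ {q r α t ts} → Mode i q r α → Matches α t →
    Step J (config (run q) (t ∷ ts)) (config r (act α t ∷ ts))
  step-mode {q} {r} {α} {t} {ts} γ = step-template {q} {r} {α} {t} {ts}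
    (∈-++⁺ʳ (simulatedPart i k P) (∈-++⁺ʳ (zerosPart i k)
      (∈-map⁺ (realize (suc k)) (∈-map⁺ oneTape (mode⁺ γ)))))

  step-zero : ∀ {j l s r ts} → j < i →
    Step J (config (run (4 + j)) (tape l s r ∷ ts)) (config (run (3 + j)) (shift left (tape l (bit 0b) r) ∷ ts))
  step-zero {j} {l} {s} {r} {ts} j<i = step-template {t = tape l s r} {ts}
    (∈-++⁺ʳ (simulatedPart i k P) (∈-++⁺ˡ (∈-applyDownFrom⁺ (realize (suc k) ∘ zeroRule) j<i))) Maybe.nothing

  step-simulated : ∀ {q r t t′ ts us} → Padded t t′ →
    Step M (config (run q) (t ∷ ts)) (config r us) →
    ∃[ u′ ] Padded (Vec.head us) u′ ×
      Step J (config (run (5 + i + q)) (t′ ∷ ts)) (config (shiftState (4 + i) r) (u′ ∷ Vec.tail us))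
  step-simulated pad (step {as = α ∷ αs} i∈ (α≈ ∷ αs≈)) = _ , act-padded α pad ,
    step (∈-++⁺ˡ (reverse⁺ (∈-map⁺ (embed (4 + i) id) i∈))) (matches-padded α pad α≈ ∷ αs≈)

  simulate⁺ : ∀ {n q t t′ ts u us} → Padded t t′ →
    Steps M n (config (run q) (t ∷ ts)) (config halt (u ∷ us)) →
    ∃[ u′ ] Padded u u′ × Steps J n (config (run (5 + i + q)) (t′ ∷ ts)) (config (run (4 + i)) (u′ ∷ us))
  simulate⁺ pad (_◅_ {d = config halt (_ ∷ _)} σ done) with step-simulated pad σ
  ... | _ , pad′ , σ′ = _ , pad′ , σ′ ◅ done
  simulate⁺ pad (_◅_ {d = config halt (_ ∷ _)} σ (() ◅ _))
  simulate⁺ pad (_◅_ {d = config (run _) (_ ∷ _)} σ σs) with step-simulated pad σ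
  ... | _ , pad′ , σ′ with simulate⁺ pad′ σs
  ... | _ , pad″ , σs′ = _ , pad″ , σ′ ◅ σs′

  -- Of the two additional steps, one erases the leading 1 and the other leaves state `4 + i`, in
  -- which the simulation ends.
  simulates : ∀ {z n y} → RunsTo M z n y → RunsTo J (1b ∷ z) (suc (n + 1)) y
  simulates {z} {n} {y} (t , ts , σs , ρ) with simulate⁺ (inputs-padded z) σs
    where
    inputs-padded : ∀ z → Padded (inputTape z) (shift right (tape [] blank (map bit z)))
    inputs-padded []      = padded
    inputs-padded (_ ∷ _) = padded
  ... | u , pad , σs′ rewrite +-identityʳ i = u , ts ,
    step-mode simulate (Maybe.just refl) ◅ (σs′ ◅◅ step-mode output Maybe.nothing ◅ done) ,
    reads-padded y pad ρ

  clear⁺ : ∀ n w {m ts} → length w + n ≡ m → Steps J (suc (length w)) (config (run 1) (wordTape (zeros n) w ∷ ts))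
    (config (run 2) (shift left (tape (zeros m) blank []) ∷ ts))
  clear⁺ n []      refl = step-mode turn (Maybe.just refl) ◅ done
  clear⁺ n (b ∷ w) {ts = ts} eq =
    subst (λ t → Step J (config (run 1) (wordTape (zeros n) (b ∷ w) ∷ ts)) (config (run 1) (t ∷ ts))) (shift-right w)
      (step-mode (clear b) (Maybe.just refl))
    ◅ clear⁺ (suc n) w (trans (+-suc (length w) n) eq)
    where
    shift-right : ∀ w {l s} → shift right (tape l s (map bit w)) ≡ wordTape (s ∷ l) w
    shift-right []      = refl
    shift-right (_ ∷ _) = refl

  -- The pending move to the left makes the statement cover `n = 0` too, where the head has already
  -- arrived at the blank.
  back⁺ : ∀ n s r {ts} → Steps J n (config (run 2) (shift left (tape (zeros n) s r) ∷ ts))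
    (config (run 2) (tape [] blank (zeros n ++ s ∷ r) ∷ ts))
  back⁺ zero    s r = done
  back⁺ (suc n) s r {ts} = step-mode back (Maybe.just refl) ◅
    subst (λ r′ → Steps J n (config (run 2) (shift left (tape (zeros n) (bit 0b) (s ∷ r)) ∷ ts)) (config (run 2) (tape [] blank r′ ∷ ts)))
      (replicate-++-∷ n _ _) (back⁺ n (bit 0b) (s ∷ r))

  zeros⁺ : ∀ m r {ts} → m ≤ i → Steps J m (config (run (3 + m)) (tape [] blank r ∷ ts))
    (config (run 3) (tape [] blank (zeros m ++ r) ∷ ts))
  zeros⁺ zero    r _   = done
  zeros⁺ (suc m) r {ts} m<i = step-zero m<i ◅
    subst (λ r′ → Steps J m (config (run (3 + m)) (tape [] blank (bit 0b ∷ r) ∷ ts)) (config (run 3) (tape [] blank r′ ∷ ts)))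
      (replicate-++-∷ m _ _) (zeros⁺ m (bit 0b ∷ r) (<⇒≤ m<i))

  reads-right : ∀ y z → Reads (shift right (tape [] blank (map bit y ++ blank ∷ z))) y
  reads-right []      z = _ , refl
  reads-right (b ∷ y) z = _ , cong (bit b ∷_) (++-assoc (map bit y) (blank ∷ z) [ blank ])

  -- The final blank is the cell visited when turning round; it is now part of the stored tape and
  -- ends the output.
  map-generated : ∀ n → map bit (0^ i 1· replicate n 0b) ++ [ blank ] ≡ zeros i ++ bit 1b ∷ zeros n ++ [ blank ]
  map-generated n
    rewrite map-++ bit (replicate i 0b) (1b ∷ replicate n 0b)
          | map-replicate bit i 0b | map-replicate bit n 0b
          = ++-assoc (zeros i) (bit 1b ∷ zeros n) [ blank ]

  generate⁺ : ∀ w {ts} → ∃[ t ] Reads t (generated i w) ×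
    Steps J (suc (length w) + (length w + suc (i + 1))) (config (run 1) (inputTape w ∷ ts)) (config halt (t ∷ ts))
  generate⁺ w {ts} rewrite inputTape≡wordTape w =
    _ , subst (λ r → Reads (shift right (tape [] blank r)) (generated i w)) (map-generated (length w))
          (reads-right (generated i w) []) ,
    (clear⁺ 0 w (+-identityʳ _)
     ◅◅ back⁺ (length w) blank []
     ◅◅ step-mode one (Maybe.just refl)
     ◅ (zeros⁺ i _ ≤-refl ◅◅ step-mode finish Maybe.nothing ◅ done))

  generationTime : Word → ℕ
  generationTime w = suc (suc (length w) + (length w + suc (i + 1)))

  generates-[] : RunsTo J [] (generationTime []) (generated i [])
  generates-[] with generate⁺ []
  ... | t , ρ , σs = t , _ , step-mode empty (Maybe.just refl) ◅ σs , ρ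

  generates-0b : ∀ z → RunsTo J (0b ∷ z) (generationTime (0b ∷ z)) (generated i (0b ∷ z))
  generates-0b z with generate⁺ (0b ∷ z)
  ... | t , ρ , σs = t , _ , step-mode generate (Maybe.just refl) ◅ σs , ρ

-- Determinism of the new transducer

compatible-sym : ∀ {x y} → Compatible x y → Compatible y x
compatible-sym anyˡ = anyʳ
compatible-sym anyʳ = anyˡ
compatible-sym same = same

overlap-sym : ∀ {k} {ι κ : Instruction k} → Overlap ι κ → Overlap κ ι
overlap-sym (eq , cs) = sym eq , Pointwise.sym compatible-sym cs

reverse-deterministic : ∀ {k} {P : Program k} → AllPairs (λ ι κ → ¬ Overlap ι κ) P →
                        AllPairs (λ ι κ → ¬ Overlap ι κ) (reverse P)
reverse-deterministic {P = P} =
  AllPairs-resp-↭ (setoid _) (λ {ι} {κ} ¬o o → ¬o (overlap-sym {ι = κ} {ι} o)) (resp₂ _) (↭⇒↭ₛ (↭-sym (↭-reverse P)))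

module _ (i k : ℕ) (P : Program (suc k)) where

  simulated-deterministic : AllPairs (λ ι κ → ¬ Overlap ι κ) P →
                            AllPairs (λ ι κ → ¬ Overlap ι κ) (simulatedPart i k P)
  simulated-deterministic det = reverse-deterministic (AllPairs.map⁺ (AllPairs.map
    (λ ¬o (eq , cs) → ¬o (+-cancelˡ-≡ (5 + i) _ _ eq , cs)) det))

  zeros-deterministic : AllPairs (λ ι κ → ¬ Overlap ι κ) (zerosPart i k)
  zeros-deterministic = AllPairs.applyDownFrom⁺₁ _ i
    (λ j<i _ (eq , _) → <-irrefl (sym (+-cancelˡ-≡ 4 _ _ eq)) j<i)

  -- The decision evaluates although `i` and `k` are variables: the source states are the numerals 0
  -- to 3 and a single `4 + i`, and rules with the same source already differ on the first tape.
  modes-deterministic : AllPairs (λ ι κ → ¬ Overlap ι κ) (modesPart i k)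
  modes-deterministic = toWitness {a? = allPairs? (λ ι κ → ¬? (overlap? ι κ)) (modesPart i k)} tt

  zeros-modes-disjoint : All (λ ι → All (λ κ → ¬ Overlap ι κ) (modesPart i k)) (zerosPart i k)
  zeros-modes-disjoint = All.applyDownFrom⁺₁ _ i λ j<i →
    (λ ()) ∷ (λ ()) ∷ (λ ()) ∷ (λ ()) ∷ (λ ()) ∷ (λ ()) ∷ (λ ()) ∷ (λ ()) ∷ (λ ()) ∷
    (λ (eq , _) → <-irrefl (+-cancelˡ-≡ 4 _ _ eq) j<i) ∷ []

  simulated-high : All (λ ι → 5 + i ≤ Instruction.from ι) (simulatedPart i k P)
  simulated-high = All.tabulate λ ι∈ → high
    (∈-map⁻ (embed (4 + i) id) {xs = P} (reverse⁻ {xs = map (embed (4 + i) id) P} ι∈))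
    where
    high : ∀ {ι} → ∃[ κ ] κ ∈ P × ι ≡ embed (4 + i) id κ → 5 + i ≤ Instruction.from ι
    high (_ , _ , refl) = m≤m+n (5 + i) _

  rest-low : All (λ ι → Instruction.from ι ≤ 4 + i) (zerosPart i k ++ modesPart i k)
  rest-low = All.++⁺ (All.applyDownFrom⁺₁ _ i (λ j<i → +-monoʳ-≤ 4 (<⇒≤ j<i)))
    (z≤n ∷ z≤n ∷ z≤n ∷ s≤s z≤n ∷ s≤s z≤n ∷ s≤s z≤n ∷ s≤s (s≤s z≤n) ∷ s≤s (s≤s z≤n) ∷ s≤s (s≤s (s≤s z≤n)) ∷ ≤-refl ∷ [])

  jumper-deterministic : Deterministic (machine k P) → Deterministic (jumper i (machine k P))
  jumper-deterministic det = AllPairs.++⁺ (simulated-deterministic det)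
    (AllPairs.++⁺ zeros-deterministic modes-deterministic zeros-modes-disjoint)
    (All.map (λ high → All.map (λ low (eq , _) → <-irrefl (sym eq) (≤-<-trans low high)) rest-low) simulated-high)

-- The codes of both machines

-- As the idle action has code 0, `pair 0` adds the idle action on the input tape to an instruction
-- of the simulated machine.
guesserCode : ℕ → ℕ
guesserCode a = pair (suc (tapesCode a)) (pair (lengthCode a + length guessRules)
  (prepend (λ j → embedCode 3 (pair 0) (entry j (bodyCode a))) (lengthCode a)
    (encodeList encodeTemplate (map guessTemplate guessRules))))

decode-guesserCode : ∀ a → decodeMachine (guesserCode a) ≡ guesser (decodeMachine a)
decode-guesserCode a = trans (decodeMachine-pair (suc k) _ _) (cong (machine (suc k))
  (trans (decodeVec-prepend-entries (decodeInstruction (suc k)) (decodeInstruction (suc (suc k)))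
           (embedCode 3 (pair 0))
           (decode-embedCode 3 {extend = idle ∷_} {pair 0} (decodeVec-pair decodeAction (suc k) 0))
           (lengthCode a) (bodyCode a))
         (cong (reverse (map (embed 3 (idle ∷_)) (Machine.program (decodeMachine a))) ++_)
           (decodeVec-encodeList (decodeInstruction (suc (suc k))) encodeTemplate (decode-encodeTemplate _)
             (map guessTemplate guessRules)))))
  where k = tapesCode a

jumperCode : ℕ → ℕ → ℕ
jumperCode i a = pair (tapesCode a) (pair (lengthCode a + (i + length (modeRules i)))
  (prepend (λ j → embedCode (4 + i) id (entry j (bodyCode a))) (lengthCode a)
    (prepend (encodeTemplate ∘ zeroRule) i
      (encodeList encodeTemplate (map oneTape (modeRules i))))))

applyDownFrom-cong : ∀ {A : Set} {f g : ℕ → A} → (∀ j → f j ≡ g j) → ∀ k → applyDownFrom f k ≡ applyDownFrom g k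
applyDownFrom-cong eq zero    = refl
applyDownFrom-cong eq (suc k) = cong₂ _∷_ (eq k) (applyDownFrom-cong eq k)

decode-jumperCode : ∀ i a → decodeMachine (jumperCode i a) ≡ jumper i (decodeMachine a)
decode-jumperCode i a = trans (decodeMachine-pair k _ _) (cong (machine k)
  (trans (decodeVec-prepend-entries d d (embedCode (4 + i) id) (decode-embedCode (4 + i) {extend = id} {id} (λ _ → refl))
           (lengthCode a) (bodyCode a))
         (cong (simulatedPart i k P ++_)
           (trans (decodeVec-prepend d (encodeTemplate ∘ zeroRule) i)
                  (cong₂ _++_ (applyDownFrom-cong (decode-encodeTemplate _ ∘ zeroRule) i)
                              (decodeVec-encodeList d encodeTemplate (decode-encodeTemplate _) (map oneTape (modeRules i))))))))
  where
  k = tapesCode a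
  P = Machine.program (decodeMachine a)
  d = decodeInstruction (suc k)

tapesᶜ : ∀ {n} {f : Vec ℕ n → ℕ} → Computable f → Computable λ xs → tapesCode (f xs)
tapesᶜ = π₁ᶜ

lengthᶜ : ∀ {n} {f : Vec ℕ n → ℕ} → Computable f → Computable λ xs → lengthCode (f xs)
lengthᶜ f = π₁ᶜ (π₂ᶜ f)

bodyᶜ : ∀ {n} {f : Vec ℕ n → ℕ} → Computable f → Computable λ xs → bodyCode (f xs)
bodyᶜ f = π₂ᶜ (π₂ᶜ f)

embedᶜ : ∀ {n} {d f : Vec ℕ n → ℕ} {extend} → Computable d → Computable₁ extend → Computable f →
  Computable λ xs → embedCode (d xs) extend (f xs)
embedᶜ {extend = g} d e f =
  encodeInstructionᶜ (sucᶜ (d +ᶜ π₁ᶜ f)) (sucᶜ (d +ᶜ π₁ᶜ (π₂ᶜ f))) (app₁ g e (π₂ᶜ (π₂ᶜ f)))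

entryᶜ : Computable₂ λ j a → entry j (bodyCode a)
entryᶜ = app₂ entry entry-computable (var 0F) (bodyᶜ (var 1F))

guesserCode-computable : Computable₁ guesserCode
guesserCode-computable =
  pairᶜ (sucᶜ (tapesᶜ (var 0F))) (pairᶜ (lengthᶜ (var 0F) +ᶜ const (length guessRules))
    (prepend-computable {f = λ j a → embedCode 3 (pair 0) (entry j (bodyCode a))} {k = lengthCode}
      {λ _ → encodeList encodeTemplate (map guessTemplate guessRules)}
      (embedᶜ {extend = pair 0} (const 3) (pairᶜ (const 0) (var 0F)) entryᶜ)
      (lengthᶜ (var 0F)) (const _)))

modesCode-computable : ∀ {i} → Computable₁ i →
  Computable₁ λ a → encodeList encodeTemplate (map oneTape (modeRules (i a)))
modesCode-computable i =
  -- Only three rules mention `i`. The targets `run (5 + i)` and `run (3 + i)` have the codes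
  -- `6 + i` and `4 + i`.
  pairᶜ (encodeInstructionᶜ (const 0) (const 6 +ᶜ i) (const _)) (pairᶜ (const _) (pairᶜ (const _)
  (pairᶜ (const _) (pairᶜ (const _) (pairᶜ (const _) (pairᶜ (const _)
  (pairᶜ (encodeInstructionᶜ (const 2) (const 4 +ᶜ i) (const _)) (pairᶜ (const _)
  (pairᶜ (encodeInstructionᶜ (const 4 +ᶜ i) (const 0) (const _)) (const 0))))))))))

jumperCode-computable : ∀ {i} → Computable₁ i → Computable₁ λ a → jumperCode (i a) a
jumperCode-computable {i} iᶜ =
  -- There are 10 mode rules.
  pairᶜ (tapesᶜ (var 0F)) (pairᶜ (lengthᶜ (var 0F) +ᶜ (iᶜ +ᶜ const 10))
    (prepend-computable {f = λ j a → embedCode (4 + i a) id (entry j (bodyCode a))} {k = lengthCode}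
      {λ a → prepend (encodeTemplate ∘ zeroRule) (i a)
               (encodeList encodeTemplate (map oneTape (modeRules (i a))))}
      (embedᶜ {extend = id} (const 4 +ᶜ app₁ i iᶜ (var 1F)) (var 0F) entryᶜ)
      (lengthᶜ (var 0F))
      (prepend-computable {f = λ j _ → encodeTemplate (zeroRule j)} {k = i}
      {λ a → encodeList encodeTemplate (map oneTape (modeRules (i a)))}
        -- The source is state `4 + j`, and `4 + j` is also the code of the target `run (3 + j)`.
        (encodeInstructionᶜ (const 4 +ᶜ var 0F) (const 4 +ᶜ var 0F) (const _))
        iᶜ (modesCode-computable {i} iᶜ))))

-- Polynomials

IsPolynomial : (ℕ → ℕ) → Set
IsPolynomial F = ∃[ p ] ∀ n → eval p n ≡ F n

isPolynomial-eval : ∀ p → IsPolynomial (eval p)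
isPolynomial-eval p = p , λ _ → refl

isPolynomial-const : ∀ c → IsPolynomial λ _ → c
isPolynomial-const c = c ∷ [] , λ n → trans (cong (c +_) (*-zeroʳ n)) (+-identityʳ c)

isPolynomial-id : IsPolynomial id
isPolynomial-id = 0 ∷ 1 ∷ [] , λ n → trans (cong (λ z → n * (1 + z)) (*-zeroʳ n)) (*-identityʳ n)

_⊕_ : Polynomial → Polynomial → Polynomial
[]      ⊕ q       = q
(a ∷ p) ⊕ []      = a ∷ p
(a ∷ p) ⊕ (b ∷ q) = a + b ∷ p ⊕ q

eval-⊕ : ∀ p q n → eval (p ⊕ q) n ≡ eval p n + eval q n
eval-⊕ []      q       n = refl
eval-⊕ (a ∷ p) []      n = sym (+-identityʳ _)
eval-⊕ (a ∷ p) (b ∷ q) n rewrite eval-⊕ p q n =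
  solve 5 (λ a b n x y → a :+ b :+ n :* (x :+ y) := a :+ n :* x :+ (b :+ n :* y)) refl
    a b n (eval p n) (eval q n)
  where open +-*-Solver

isPolynomial-+ : ∀ {F G} → IsPolynomial F → IsPolynomial G → IsPolynomial λ n → F n + G n
isPolynomial-+ (p , p≡) (q , q≡) = p ⊕ q , λ n → trans (eval-⊕ p q n) (cong₂ _+_ (p≡ n) (q≡ n))

isPolynomial-scale : ∀ c p → IsPolynomial λ n → c * eval p n
isPolynomial-scale c []      = [] , λ _ → sym (*-zeroʳ c)
isPolynomial-scale c (a ∷ p) with isPolynomial-scale c p
... | q , q≡ = c * a ∷ q , λ n → trans (cong (λ z → c * a + n * z) (q≡ n))
  (solve 4 (λ c a n x → c :* a :+ n :* (c :* x) := c :* (a :+ n :* x)) refl c a n (eval p n))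
  where open +-*-Solver

isPolynomial-* : ∀ {F G} → IsPolynomial F → IsPolynomial G → IsPolynomial λ n → F n * G n
isPolynomial-* {F} {G} (p , p≡) (q , q≡) with times p
  where
  times : ∀ p → IsPolynomial λ n → eval p n * eval q n
  times []      = [] , λ _ → refl
  times (a ∷ p) with times p
  ... | r , r≡ with isPolynomial-+ (isPolynomial-scale a q) (0 ∷ r , λ n → cong (n *_) (r≡ n))
  ... | s , s≡ = s , λ n → trans (s≡ n)
    (solve 4 (λ a n x y → a :* y :+ n :* (x :* y) := (a :+ n :* x) :* y) refl a n (eval p n) (eval q n))
    where open +-*-Solver
... | r , r≡ = r , λ n → trans (r≡ n) (cong₂ _*_ (p≡ n) (q≡ n))

isPolynomial-∘ : ∀ p {F} → IsPolynomial F → IsPolynomial λ n → eval p (F n)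
isPolynomial-∘ []      F-poly = isPolynomial-const 0
isPolynomial-∘ (a ∷ p) F-poly =
  isPolynomial-+ (isPolynomial-const a) (isPolynomial-* F-poly (isPolynomial-∘ p F-poly))

eval-mono : ∀ p {m n} → m ≤ n → eval p m ≤ eval p n
eval-mono []      m≤n = z≤n
eval-mono (a ∷ p) m≤n = +-monoʳ-≤ a (*-mono-≤ m≤n (eval-mono p m≤n))

-- The jump operator

-- Serves to exclude the lengths up to `i`, which are too short for a word `0^i 1 0^j`.
bounded-up-to : ∀ (t : ℕ → ℕ) m → ∃[ K ] ∀ n → n ≤ m → t n ≤ K
bounded-up-to t zero = t 0 , λ { zero z≤n → ≤-refl }
bounded-up-to t (suc m) with bounded-up-to t m
... | K , t≤K = t (suc m) + K , bound
  where
  bound : ∀ n → n ≤ suc m → t n ≤ t (suc m) + K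
  bound n n≤ with m≤n⇒m<n∨m≡n n≤
  ... | inj₁ n<   = ≤-trans (t≤K n (s≤s⁻¹ n<)) (m≤n+m K _)
  ... | inj₂ refl = m≤m+n _ K

-- If there were no least witness, strong induction would refute every `Q m` with `m ≤ n`. `Q` is
-- not assumed decidable, hence the double negation.
¬¬-least : ∀ (Q : ℕ → Set) {n} → Q n →
  ¬ ¬ (∃[ m ] m ≤ n × Q m × (∀ k → k < m → ¬ Q k))
¬¬-least Q {n} qn ¬least = <-rec (λ m → m ≤ n → ¬ Q m)
  (λ m below m≤n qm → ¬least (m , m≤n , qm , λ k k<m → below k<m (≤-trans (<⇒≤ k<m) m≤n)))
  n ≤-refl qn

-- The proof of determinism inside `𝐏` comes from the decision procedure and may differ from the
-- given one.
transducer-with-code : ∀ a {nz M} → decodeMachine a ≡ M → Deterministic M →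
  ∃[ d ] 𝐏 (suc a , nz) ≡ transducer M d
transducer-with-code a refl det with deterministic? (decodeMachine a)
... | yes d = d , refl
... | no ¬d = contradiction det ¬d

𝐏-cases : ∀ a {nz} → (∃[ d ] 𝐏 (suc a , nz) ≡ transducer (decodeMachine a) d) ⊎
                     𝐏 (suc a , nz) ≡ transducer (machine 0 []) []
𝐏-cases a with deterministic? (decodeMachine a)
... | yes d = inj₁ (d , refl)
... | no _  = inj₂ refl

-- Without instructions the machine stays in its start state, which is not `halt`; so codes of
-- machines that are not deterministic require no jump.
no-empty-proofSystem : ∀ {A} → ¬ ProofSystem (transducer (machine 0 []) []) A
no-empty-proofSystem f with ProofSystem.computes f []
... | _ , _ , _ , _ , step () _ ◅ _ , _

module Jump (U : Acceptor) (universal : Universal U) (t : ℕ → ℕ) (nonPolynomial : NonPolynomial t)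
            (k : ℕ) (P : Program (suc k)) (det : Deterministic (machine k P))
            (i : ℕ⁺) (i-codes : 𝐍 i ≡ guesser (machine k P))
            (f : ProofSystem (transducer (machine k P) det) (L U t)) where

  open Guesser k P using (G; sound; complete)
  open Jumper (value i) k P using (J; generationTime; generates-[]; generates-0b; simulates)
  open ProofSystem f renaming (function to F)

  input : ℕ → Word
  input j = 0^ value i 1· replicate j 0b

  accepted⇒∈L : ∀ {x} → Accepts G x → L U t x
  accepted⇒∈L acc with sound acc
  ... | y , n , u , us , σs , ρ = proj₁ range
    (y , output-unique (transducer (machine k P) det) (proj₂ (proj₂ (computes y))) (u , us , σs , ρ))

  -- A fast acceptance of x by U would put x outside of L, yet U accepts
  -- only if N_i does, that is, only if x is in the range of F.
  not-early : ∀ j → ¬ (∃[ n ] n < t (length (input j)) × AcceptsIn U (input j) n)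
  not-early j (n , n<t , acc)
    with accepted⇒∈L (subst (λ N → Accepts N (input j)) i-codes
           (Equivalence.to (Universal.simulates universal i (replicate j 0b)) (n , acc)))
  ... | _ , _ , ¬early = ¬early (n , n<t , acc)

  input∈L : ∀ j → L U t (input j)
  input∈L j = i , (j , refl) , not-early j

  jump : Word → Word
  jump []             = input 0
  jump (zero ∷ z)     = input (suc (length z))
  jump (suc zero ∷ z) = F z

  jumpBound : IsPolynomial λ n → suc (suc n + (n + suc (value i + 1))) + eval bound n
  jumpBound = isPolynomial-+ (isPolynomial-+ (isPolynomial-const 1)
    (isPolynomial-+ (isPolynomial-+ (isPolynomial-const 1) isPolynomial-id)
    (isPolynomial-+ isPolynomial-id (isPolynomial-const _)))) (isPolynomial-eval bound)

  jump-computes : ∀ w → ∃[ s ] s ≤ eval (proj₁ jumpBound) (length w) × RunsTo J w s (jump w)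
  jump-computes w rewrite proj₂ jumpBound (length w) = runs w
    where
    runs : ∀ w → ∃[ s ] s ≤ suc (suc (length w) + (length w + suc (value i + 1))) + eval bound (length w) ×
                        RunsTo J w s (jump w)
    runs []             = _ , m≤m+n _ _ , generates-[]
    runs (zero ∷ z)     = _ , m≤m+n _ _ , generates-0b z
    runs (suc zero ∷ z) with computes z
    ... | s , s≤ , out = _ , bounded , simulates out
      where
      bounded : suc (s + 1) ≤ suc (suc (suc (length z)) + (suc (length z) + suc (value i + 1))) +
                              eval bound (suc (length z))
      -- The generation time is at least 2 and so pays for the two additional steps.
      bounded rewrite +-comm s 1 = +-mono-≤ (s≤s (s≤s z≤n)) (≤-trans s≤ (eval-mono bound (n≤1+n (length z))))

  jump-range : (λ y → ∃[ x ] jump x ≡ y) ≐ L U t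
  jump-range = (λ { (w , refl) → jump∈L w }) ,
               (λ y∈L → let x , eq = proj₂ range y∈L in 1b ∷ x , eq)
    where
    jump∈L : ∀ w → L U t (jump w)
    jump∈L []             = input∈L 0
    jump∈L (zero ∷ z)     = input∈L (suc (length z))
    jump∈L (suc zero ∷ z) = proj₁ range (z , refl)

  jump-zeros : ∀ j → jump (replicate j 0b) ≡ input j
  jump-zeros zero    = refl
  jump-zeros (suc j) = cong (input ∘ suc) (length-replicate j)

  length-input : ∀ j → length (input j) ≡ value i + suc j
  length-input j rewrite length-++ (replicate (value i) 0b) {1b ∷ replicate j 0b}
    | length-replicate (value i) {0b} | length-replicate j {0b} = refl

  not-simulated : ¬ Simulates F jump
  not-simulated (π , p , simulation) = ¬¬-least (AcceptsIn (𝐍 i) x) slow-accepted absurd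
    where
    Q : ℕ → ℕ
    -- The bound of `complete` for a word of length `n` with a preimage of length at most
    -- `eval p n`.
    Q n = suc (eval p n * 2) + (eval bound (eval p n) + suc n)

    Q-polynomial : IsPolynomial Q
    Q-polynomial =
      isPolynomial-+ (isPolynomial-+ (isPolynomial-const 1) (isPolynomial-* (isPolynomial-eval p) (isPolynomial-const 2)))
        (isPolynomial-+ (isPolynomial-∘ bound (isPolynomial-eval p)) (isPolynomial-+ (isPolynomial-const 1) isPolynomial-id))

    accepted : ∀ j → ∃[ m ] m ≤ Q (length (input j)) × AcceptsIn (𝐍 i) (input j) m
    accepted j with simulation (replicate j 0b)
    ... | π≤ , Fπ≡ with computes (π (replicate j 0b))
    ... | s , s≤ , u , us , σs , ρ
      with complete σs (subst (Reads u) (trans Fπ≡ (jump-zeros j)) ρ)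
    ... | m , m≤ , acc = m ,
      ≤-trans m≤ (+-mono-≤ (s≤s (*-monoˡ-≤ 2 π≤′))
        (+-monoˡ-≤ _ (≤-trans s≤ (eval-mono bound π≤′)))) ,
      subst (λ N → AcceptsIn N (input j) m) (sym i-codes) acc
      where
      j≤ : length (replicate j 0b) ≤ length (input j)
      j≤ rewrite length-input j | length-replicate j {0b} = ≤-trans (n≤1+n j) (m≤n+m (suc j) (value i))
      π≤′ : length (π (replicate j 0b)) ≤ eval p (length (input j))
      π≤′ = ≤-trans π≤ (eval-mono p j≤)

    c K : ℕ
    c = proj₁ (Universal.overhead universal i)
    K = proj₁ (bounded-up-to t (value i))

    -- `c * Q n + c` bounds the time of `U`, `suc` makes the comparison with `t` strict, and `K`
    -- excludes `n` up to `i`, where `t` is at most `K`.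
    R-polynomial : IsPolynomial λ n → suc (c * Q n + c) + K
    R-polynomial = isPolynomial-+ (isPolynomial-+ (isPolynomial-const 1)
      (isPolynomial-+ (isPolynomial-* (isPolynomial-const c) Q-polynomial) (isPolynomial-const c))) (isPolynomial-const K)

    n : ℕ
    n = proj₁ (nonPolynomial (proj₁ R-polynomial))

    R≤t : suc (c * Q n + c) + K ≤ t n
    R≤t = subst (_≤ t n) (proj₂ R-polynomial n) (proj₂ (nonPolynomial (proj₁ R-polynomial)))

    i<n : value i < n
    i<n = ≰⇒> λ n≤i → <-irrefl refl (≤-trans (s≤s (m≤n+m K (c * Q n + c)))
                         (≤-trans R≤t (proj₂ (bounded-up-to t (value i)) n n≤i)))

    j : ℕ
    j = n ∸ suc (value i)

    x : Word
    x = input j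

    length-x : length x ≡ n
    length-x = trans (length-input j) (trans (+-suc (value i) j) (m+[n∸m]≡n i<n))

    slow-accepted : AcceptsIn (𝐍 i) x (proj₁ (accepted j))
    slow-accepted = proj₂ (proj₂ (accepted j))

    absurd : ¬ (∃[ m ] m ≤ proj₁ (accepted j) × AcceptsIn (𝐍 i) x m × (∀ l → l < m → ¬ AcceptsIn (𝐍 i) x l))
    absurd (m , m≤ , acc , least)
      with proj₂ (Universal.overhead universal i) (replicate j 0b) m (acc , least)
    ... | l , (acc′ , _) , l≤ = not-early j (l , l<t , acc′)
      where
      m≤Q : m ≤ Q n
      m≤Q = subst (λ z → m ≤ Q z) length-x (≤-trans m≤ (proj₁ (proj₂ (accepted j))))
      l<t : l < t (length x)
      l<t rewrite length-x = ≤-trans (s≤s (≤-trans l≤ (+-monoˡ-≤ c (*-monoʳ-≤ c m≤Q))))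
                               (≤-trans (m≤m+n _ K) R≤t)

  jumpSystem : (d : Deterministic J) →
    Σ[ g ∈ ProofSystem (transducer J d) (L U t) ] ¬ Simulates F (ProofSystem.function g)
  jumpSystem d = record
    { function = jump ; bound = proj₁ jumpBound ; computes = jump-computes ; range = jump-range } ,
    not-simulated

-- Indices of `𝐍` and `𝐏` exceed the number given to `decodeMachine` by one.
index : ℕ → ℕ
index a = suc (guesserCode a)

jumpOperator : ℕ⁺ → ℕ⁺
jumpOperator (a , _) = suc (jumperCode (index (pred a)) (pred a)) , _

jumpOperator-recursive : Recursive jumpOperator
jumpOperator-recursive = proj₁ computed , λ a → proj₂ computed (value a ∷ [])
  where
  computed : Computable₁ λ a → suc (jumperCode (index (pred a)) (pred a))
  computed = sucᶜ (app₁ (λ a → jumperCode (index a) a)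
    (jumperCode-computable {index} (sucᶜ guesserCode-computable)) (app₁ pred pred-computable (var 0F)))

theorem7 : (U : Acceptor) → Universal U →
    (t : ℕ → ℕ) → NonPolynomial t → TimeConstructible t →
    HasRecursiveJumpOperator (L U t)
theorem7 U universal t nonPolynomial _ = jumpOperator , jumps , jumpOperator-recursive
  where
  jumps : JumpOperator (L U t) jumpOperator
  jumps (zero , ())
  jumps (suc a , nz) f with 𝐏-cases a {nz}
  ... | inj₂ eq       = contradiction (subst (λ T → ProofSystem T (L U t)) eq f) no-empty-proofSystem
  ... | inj₁ (d , eq) = jumpFrom d eq f
    where
    -- With a variable `T` in place of `𝐏 (suc a , nz)` the equation can be matched with `refl`.
    jumpFrom : ∀ {T} d → T ≡ transducer (decodeMachine a) d → (f : ProofSystem T (L U t)) →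
      Σ[ g ∈ ProofSystem (𝐏 (jumpOperator (suc a , nz))) (L U t) ]
        ¬ Simulates (ProofSystem.function f) (ProofSystem.function g)
    jumpFrom d refl f with transducer-with-code (jumperCode (index a) a) (decode-jumperCode (index a) a)
                             (jumper-deterministic (index a) (Machine.extraTapes M) (Machine.program M) d)
      where M = decodeMachine a
    ... | d′ , eq = subst
      (λ T → Σ[ g ∈ ProofSystem T (L U t) ] ¬ Simulates (ProofSystem.function f) (ProofSystem.function g)) (sym eq)
      (Jump.jumpSystem U universal t nonPolynomial (Machine.extraTapes M) (Machine.program M) d
        (index a , _) (decode-guesserCode a) f d′)
      where M = decodeMachine a
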